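{- Let $G$ be a finite abelian group. If there is an odd prime $p$ such that the Sylow $p$-subgroup of $G$ is neither cyclic nor elementary abelian of rank $2$, then $G$ admits a proper Cayley digraph with Cayley index $p$ whose automorphism group contains a nonabelian regular subgroup.
   Context: A digraph has vertex set and arc set of ordered pairs of distinct vertices (no loops); it is proper if some arc $(u,v)$ has $(v,u)$ not an arc. For $S\subseteq G\setminus\{1\}$, the Cayley digraph $\mathrm{Cay}(G,S)$ has vertex set $G$ and arcs $(u,v)$ whenever $vu^{ -1}\in S$. $G$ acts on it by right multiplication, and the Cayley index is $|\mathrm{Aut}(\mathrm{Cay}(G,S)):G|$, where $\mathrm{Aut}$ is the group of arc-preserving vertex permutations. A subgroup is regular if it acts regularly on the vertex set. -}

module Defs where

open import Level using (0ℓ)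
open import Data.Nat using (ℕ; zero; suc; _+_; _*_; _^_)
open import Data.Nat.Divisibility using (_∣_)
open import Data.Nat.Primality using (Prime)
open import Data.Fin using (Fin)
open import Data.Fin.Subset using (Subset; _∈_; _∉_; ∣_∣)
open import Data.Fin.Permutation
  using (Permutation′; _⟨$⟩ʳ_; _∘ₚ_; flip; id)
  renaming (_≈_ to _≈ₚ_)
open import Data.Product using (Σ; ∃; ∃-syntax; _×_; _,_)
open import Relation.Nullary using (¬_)
open import Relation.Unary using (Pred)
open import Relation.Binary.PropositionalEquality using (_≡_)
open import Function.Bundles using (_⇔_)

-- Finite abelian groups, with carrier Fin n (every finite group is
-- isomorphic to one of this form).

record FiniteAbelianGroup : Set where
  field
    n     : ℕ
    _·_   : Fin n → Fin n → Fin n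
    e     : Fin n
    inv   : Fin n → Fin n
    assoc : ∀ x y z → (x · y) · z ≡ x · (y · z)
    idˡ   : ∀ x → e · x ≡ x
    invˡ  : ∀ x → inv x · x ≡ e
    comm  : ∀ x y → x · y ≡ y · x

  infixl 7 _·_

  pow : Fin n → ℕ → Fin n
  pow g zero    = e
  pow g (suc k) = g · pow g k

  record IsSubgroup (H : Subset n) : Set where
    field
      e∈   : e ∈ H
      ·∈   : ∀ {x y} → x ∈ H → y ∈ H → x · y ∈ H
      inv∈ : ∀ {x} → x ∈ H → inv x ∈ H

  IsSylow : ℕ → Subset n → Set
  IsSylow p H = IsSubgroup H × ∃[ a ] (∣ H ∣ ≡ p ^ a × ¬ (p ^ suc a ∣ n))

  IsCyclic : Subset n → Set
  IsCyclic H = ∃[ g ] (g ∈ H × (∀ x → x ∈ H → ∃[ k ] x ≡ pow g k))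

  IsElemAbRank2 : ℕ → Subset n → Set
  IsElemAbRank2 p H = ∣ H ∣ ≡ p ^ 2 × (∀ x → x ∈ H → pow x p ≡ e)

  Arc : Subset n → Fin n → Fin n → Set
  Arc S u v = (v · inv u) ∈ S

  IsProper : Subset n → Set
  IsProper S = ∃[ u ] ∃[ v ] (Arc S u v × ¬ Arc S v u)

  IsAut : Subset n → Permutation′ n → Set
  IsAut S σ = ∀ u v → Arc S u v ⇔ Arc S (σ ⟨$⟩ʳ u) (σ ⟨$⟩ʳ v)

  Aut : Subset n → Set
  Aut S = Σ (Permutation′ n) (IsAut S)

  AutCard : Subset n → ℕ → Set
  AutCard S k =
    Σ (Fin k → Aut S) λ f →
      (∀ i j → Σ.proj₁ (f i) ≈ₚ Σ.proj₁ (f j) → i ≡ j)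
      × (∀ (σ : Aut S) → ∃[ i ] Σ.proj₁ (f i) ≈ₚ Σ.proj₁ σ)

  -- Cayley index |Aut(Cay(G,S)) : G| = m, i.e. |Aut| = m · |G|.
  CayleyIndex : Subset n → ℕ → Set
  CayleyIndex S m = AutCard S (m * n)

  record IsAutSubgroup (S : Subset n) (R : Pred (Permutation′ n) 0ℓ) : Set where
    field
      aut  : ∀ {σ} → R σ → IsAut S σ
      id∈  : R id
      ∘∈   : ∀ {σ τ} → R σ → R τ → R (σ ∘ₚ τ)
      inv∈ : ∀ {σ} → R σ → R (flip σ)

  IsRegular : Pred (Permutation′ n) 0ℓ → Set
  IsRegular R =
    ∀ u v → (∃[ σ ] (R σ × σ ⟨$⟩ʳ u ≡ v))
          × (∀ σ τ → R σ → R τ → σ ⟨$⟩ʳ u ≡ v → τ ⟨$⟩ʳ u ≡ v → σ ≈ₚ τ)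

  IsNonabelian : Pred (Permutation′ n) 0ℓ → Set
  IsNonabelian R = ∃[ σ ] ∃[ τ ] (R σ × R τ × ¬ ((σ ∘ₚ τ) ≈ₚ (τ ∘ₚ σ)))

  HasNonabelianRegularSubgroup : Subset n → Set₁
  HasNonabelianRegularSubgroup S =
    ∃[ R ] (IsAutSubgroup S R × IsRegular R × IsNonabelian R)

{-# OPTIONS --safe #-}
module Submission where

-- Write p = 3 + q. Choose homomorphisms ψ, ω : G → ℤ/p and elements a, b, c, z such that
-- φ(x) = x c^ψ(x) z^ω(x) is an automorphism of order p with φ(a) = a c, φ(b) = b z; this uses
-- that the Sylow subgroup is neither cyclic nor elementary abelian of rank 2. The maps
-- x ↦ φ^ψ(r)(x) r form a regular group, which is nonabelian as φ moves b ∈ ker ψ. It remains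
-- to find a φ-invariant connection set S such that every automorphism fixing the identity is
-- a power of φ.
--
-- On ⟨a, b, c, z⟩ the set consisting of z and the φ-orbits of b, a and ab works: an arc of
-- type z has at least three common out-neighbours of its ends, type b exactly two, and the
-- others at most one, so arc types are preserved. A type-preserving map that fixes x and
-- a x then also fixes the translates of these by z, b, a and c.
--
-- If S works on a subgroup H, and φ fixes g ∉ H, then (H ∖ {1} ∖ S) ∪ {g} works on ⟨H, g⟩:
-- the arcs inside H have at least two common out-neighbours of their ends, the arcs of g at
-- most one. Since G is generated by a, b and the fixed points of φ, this reaches G.

open import Defs
open import Level using (0ℓ)
open import Algebra.Bundles using (CommutativeMonoid)
open import Data.Nat using (ℕ; zero; suc; _+_; _*_; _^_; _∸_; _<_; _≤_; s≤s; z≤n; NonZero; ≢-nonZero)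
open import Data.Nat.Properties as ℕₚ using (+-comm; *-comm; +-assoc; *-suc)
open import Data.Nat.Coprimality using (Coprime; coprime-Bézout; coprime-/gcd)
open import Data.Nat.DivMod
open import Data.Nat.Divisibility using (_∣_; divides; _∣?_; ∣⇒≤; m%n≡0⇒n∣m)
open import Data.Nat.GCD using (gcd; gcd[m,n]∣m; gcd[m,n]∣n; gcd[m,n]≢0; module Bézout)
open import Data.Nat.Induction using (<-rec)
open import Data.Nat.Primality using (Prime; euclidsLemma; prime⇒irreducible; ¬prime[0]; ¬prime[1])
open import Data.Nat.Tactic.RingSolver using (solve-∀)
open import Data.Fin as Fin using (Fin; toℕ; fromℕ<; combine; remQuot)
open import Data.Fin.Properties as Finₚ using (any?; ¬∀⟶∃¬)
open import Data.Fin.Permutation as Perm using (Permutation′; permutation; _⟨$⟩ʳ_; _⟨$⟩ˡ_)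
open import Data.Fin.Subset using (Subset; ∣_∣; inside; outside; ⊤)
  renaming (_∈_ to _∈ₛ_; _∉_ to _∉ₛ_)
open import Data.Fin.Subset.Properties as Subsetₚ using (_∈?_)
open import Data.Vec using ([]; _∷_; here; there; tabulate)
open import Data.Vec.Properties using (lookup∘tabulate; lookup⇒[]=; []=⇒lookup)
open import Data.Product using (Σ; ∃-syntax; _×_; _,_; proj₁; proj₂)
open import Data.Sum using (_⊎_; inj₁; inj₂; [_,_]′)
open import Data.Empty using (⊥; ⊥-elim)
open import Function using (_∘_; case_of_)
open import Function.Bundles using (mk⇔; Equivalence)
open import Relation.Nullary using (¬_; Dec; yes; no; does)
open import Relation.Nullary.Decidable using (map′; _×-dec_; _⊎-dec_; ¬?; dec-true; decidable-stable)
open import Relation.Unary using (Pred; Decidable)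
open import Relation.Binary.PropositionalEquality
open ≡-Reasoning

-- The data for φ come from a dichotomy. If every element of order p is a p-th power, all characters
-- to ℤ/p kill such elements: c and z may be any independent pair of order p, while ψ, ω are dual to
-- elements a, b independent modulo p-th powers; then ω(c) = 0. Otherwise some w of order p is not a
-- p-th power, and b = c = w with ω(w) = 1; z is taken in ker ω, and a outside the subgroup
-- generated by w, z and all p-th powers. If no such a exists, the Sylow subgroup is elementary
-- abelian of rank 2.
--
-- If c = b, then φ(a) = ab and the orbits of a and ab coincide; if ω(c) = 0, then ω tells them
-- apart. The counting argument treats both cases through the union of the two orbits.
--
-- The extension step takes complements because g alone can be recognised only against arcs with
-- more common out-neighbours. In S itself the arcs of types a and ab have at most one, just as
-- those of g; in the complement within H every element of H has at least two. Arcs of S are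
-- recovered afterwards as those inside H that are not in the complement.
--
-- Oddness of p enters through p dividing (p choose 2), and through 2 being a residue other than 0
-- and 1.

-- Finite abelian groups: powers, decidable subgroups, saturation.

module GroupTheory (G : FiniteAbelianGroup) where
  open FiniteAbelianGroup G public

  idʳ : ∀ x → x · e ≡ x
  idʳ x = trans (comm x e) (idˡ x)

  invʳ : ∀ x → x · inv x ≡ e
  invʳ x = trans (comm x (inv x)) (invˡ x)

  commutativeMonoid : CommutativeMonoid 0ℓ 0ℓ
  commutativeMonoid = record
    { Carrier = Fin n ; _≈_ = _≡_ ; _∙_ = _·_ ; ε = e
    ; isCommutativeMonoid = record
      { isMonoid = record
        { isSemigroup = record
          { isMagma = record { isEquivalence = isEquivalence ; ∙-cong = cong₂ _·_ }
          ; assoc = assoc }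
        ; identity = idˡ , idʳ }
      ; comm = comm } }

  open import Algebra.Solver.CommutativeMonoid commutativeMonoid public
    using (solve; _⊕_; _⊜_)
  open import Algebra.Properties.CommutativeMonoid.Sum commutativeMonoid
    using (sum; sum-permute; ∑-distrib-+; sum-cong-≗)

  cancelˡ : ∀ x {y y′} → x · y ≡ x · y′ → y ≡ y′
  cancelˡ x {y} {y′} eq = begin
    y                  ≡⟨ sym (shift y) ⟩
    inv x · (x · y)    ≡⟨ cong (inv x ·_) eq ⟩
    inv x · (x · y′)   ≡⟨ shift y′ ⟩
    y′                 ∎
    where
    shift : ∀ w → inv x · (x · w) ≡ w
    shift w = trans (sym (assoc _ _ _)) (trans (cong (_· w) (invˡ x)) (idˡ w))

  cancelʳ : ∀ x {y y′} → y · x ≡ y′ · x → y ≡ y′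
  cancelʳ x {y} {y′} eq = cancelˡ x (trans (comm x y) (trans eq (comm y′ x)))

  ·-inv-· : ∀ u v → (v · inv u) · u ≡ v
  ·-inv-· u v = trans (assoc _ _ _) (trans (cong (v ·_) (invˡ u)) (idʳ v))

  inv-unique : ∀ x y → x · y ≡ e → y ≡ inv x
  inv-unique x y eq = cancelˡ x (trans eq (sym (invʳ x)))

  inv-involutive : ∀ x → inv (inv x) ≡ x
  inv-involutive x = sym (inv-unique (inv x) x (invˡ x))

  pow-+ : ∀ x i j → pow x (i + j) ≡ pow x i · pow x j
  pow-+ x zero    j = sym (idˡ _)
  pow-+ x (suc i) j = trans (cong (x ·_) (pow-+ x i j)) (sym (assoc _ _ _))

  pow-1 : ∀ x → pow x 1 ≡ x
  pow-1 = idʳ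

  pow-e : ∀ i → pow e i ≡ e
  pow-e zero    = refl
  pow-e (suc i) = trans (idˡ _) (pow-e i)

  pow-* : ∀ x i j → pow x (i * j) ≡ pow (pow x i) j
  pow-* x i zero    = cong (pow x) (ℕₚ.*-zeroʳ i)
  pow-* x i (suc j) = begin
    pow x (i * suc j)          ≡⟨ cong (pow x) (*-suc i j) ⟩
    pow x (i + i * j)          ≡⟨ pow-+ x i (i * j) ⟩
    pow x i · pow x (i * j)    ≡⟨ cong (pow x i ·_) (pow-* x i j) ⟩
    pow x i · pow (pow x i) j  ∎

  pow-comm : ∀ x i j → pow (pow x i) j ≡ pow (pow x j) i
  pow-comm x i j =
    trans (sym (pow-* x i j)) (trans (cong (pow x) (*-comm i j)) (pow-* x j i))

  pow-· : ∀ x y i → pow (x · y) i ≡ pow x i · pow y i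
  pow-· x y zero    = sym (idˡ e)
  pow-· x y (suc i) = trans (cong (x · y ·_) (pow-· x y i))
    (solve 4 (λ x y u v → (x ⊕ y) ⊕ (u ⊕ v) ⊜ (x ⊕ u) ⊕ (y ⊕ v)) refl x y _ _)

  pow-inv : ∀ x i → pow (inv x) i ≡ inv (pow x i)
  pow-inv x i = inv-unique _ _
    (trans (sym (pow-· x (inv x) i)) (trans (cong (λ w → pow w i) (invʳ x)) (pow-e i)))

  pow-*≡e : ∀ {x N} → pow x N ≡ e → ∀ k → pow x (k * N) ≡ e
  pow-*≡e {x} {N} x^N k = trans (pow-* x k N) (trans (pow-comm x k N)
    (trans (cong (λ w → pow w k) x^N) (pow-e k)))

  pow-% : ∀ {x N} .{{_ : NonZero N}} → pow x N ≡ e → ∀ i → pow x (i % N) ≡ pow x i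
  pow-% {x} {N} x^N i = sym (begin
    pow x i                                 ≡⟨ cong (pow x) (m≡m%n+[m/n]*n i N) ⟩
    pow x (i % N + (i / N) * N)             ≡⟨ pow-+ x (i % N) _ ⟩
    pow x (i % N) · pow x ((i / N) * N)     ≡⟨ cong (pow x (i % N) ·_) (pow-*≡e x^N (i / N)) ⟩
    pow x (i % N) · e                       ≡⟨ idʳ _ ⟩
    pow x (i % N)                           ∎)

  pow-≡% : ∀ {x N} .{{_ : NonZero N}} → pow x N ≡ e → ∀ {i j} → i % N ≡ j % N →
           pow x i ≡ pow x j
  pow-≡% x^N {i} {j} eq =
    trans (sym (pow-% x^N i)) (trans (cong (pow _) eq) (pow-% x^N j))

  pow-coprime : ∀ {x N t} → Coprime t N → pow x N ≡ e → ∃[ s ] pow (pow x t) s ≡ x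
  pow-coprime {x} {N} {t} t⊥N x^N with coprime-Bézout t⊥N
  ... | Bézout.+- s y eq = s , (begin
    pow (pow x t) s        ≡⟨ sym (pow-* x t s) ⟩
    pow x (t * s)          ≡⟨ cong (pow x) (trans (*-comm t s) (sym eq)) ⟩
    x · pow x (y * N)      ≡⟨ cong (x ·_) (pow-*≡e x^N y) ⟩
    x · e                  ≡⟨ idʳ x ⟩
    x                      ∎)
  -- Here `1 + s * t ≡ y * N`, so the exponent `t * s` inverts `x`. Applying it a second time undoes
  -- the inversion without leaving the natural exponents.
  ... | Bézout.-+ s y eq = s * t * s , (begin
    pow (pow x t) (s * t * s)         ≡⟨ cong (pow (pow x t)) (ℕₚ.*-assoc s t s) ⟩
    pow (pow x t) (s * (t * s))       ≡⟨ pow-* (pow x t) s (t * s) ⟩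
    pow (pow (pow x t) s) (t * s)     ≡⟨ cong (λ w → pow w (t * s)) x^ts ⟩
    pow (inv x) (t * s)               ≡⟨ pow-inv x (t * s) ⟩
    inv (pow x (t * s))               ≡⟨ cong inv (trans (pow-* x t s) x^ts) ⟩
    inv (inv x)                       ≡⟨ inv-involutive x ⟩
    x                                 ∎)
    where
    x^ts : pow (pow x t) s ≡ inv x
    x^ts = inv-unique x _ (begin
      x · pow (pow x t) s   ≡⟨ cong (x ·_) (trans (sym (pow-* x t s)) (cong (pow x) (*-comm t s))) ⟩
      pow x (1 + s * t)     ≡⟨ cong (pow x) eq ⟩
      pow x (y * N)         ≡⟨ pow-*≡e x^N y ⟩
      e                     ∎)

  -- Multiplication by x permutes H, so the product of H equals x^|H| times itself.
  pow-∣∣ : ∀ {H} → IsSubgroup H → ∀ {x} → x ∈ₛ H → pow x ∣ H ∣ ≡ e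
  pow-∣∣ {H} H≤G {x} x∈H = cancelʳ (sum f) (begin
    pow x ∣ H ∣ · sum f        ≡⟨ cong (_· sum f) (sym (sum-const H)) ⟩
    sum (κ H) · sum f          ≡⟨ sym (∑-distrib-+ (κ H) f) ⟩
    sum (λ i → κ H i · f i)    ≡⟨ sum-cong-≗ (λ i → sym (f-shift i)) ⟩
    sum (λ i → f (x · i))      ≡⟨ sym (sum-permute f translation) ⟩
    sum f                      ≡⟨ sym (idˡ _) ⟩
    e · sum f                  ∎)
    where
    open IsSubgroup H≤G
    κ : ∀ {m} → Subset m → Fin m → Fin n
    κ K i with i ∈? K
    ... | yes _ = x
    ... | no  _ = e
    f : Fin n → Fin n
    f i with i ∈? H
    ... | yes _ = i
    ... | no  _ = e
    translation : Permutation′ n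
    translation = permutation (x ·_) (inv x ·_)
      (λ i → trans (sym (assoc _ _ _)) (trans (cong (_· i) (invʳ x)) (idˡ i)))
      (λ i → trans (sym (assoc _ _ _)) (trans (cong (_· i) (invˡ x)) (idˡ i)))
    f-shift : ∀ i → f (x · i) ≡ κ H i · f i
    f-shift i with i ∈? H | x · i ∈? H
    ... | yes _   | yes _    = refl
    ... | no _    | no _     = sym (idˡ e)
    ... | yes i∈H | no xi∉H  = ⊥-elim (xi∉H (·∈ x∈H i∈H))
    ... | no i∉H  | yes xi∈H = ⊥-elim (i∉H (subst (_∈ₛ H)
      (trans (sym (assoc _ _ _)) (trans (cong (_· i) (invˡ x)) (idˡ i)))
      (·∈ (inv∈ x∈H) xi∈H)))
    κ-suc : ∀ {m} s (K : Subset m) i → κ (s ∷ K) (Fin.suc i) ≡ κ K i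
    κ-suc s K i with i ∈? K | Fin.suc i ∈? (s ∷ K)
    ... | yes _   | yes _ = refl
    ... | no _    | no _  = refl
    ... | yes i∈K | no ¬p = ⊥-elim (¬p (there i∈K))
    ... | no i∉K  | yes (there i∈K) = ⊥-elim (i∉K i∈K)
    sum-const : ∀ {m} (K : Subset m) → sum (κ K) ≡ pow x ∣ K ∣
    sum-const []            = refl
    sum-const (inside ∷ K)  = cong (x ·_) (trans (sum-cong-≗ (κ-suc inside K)) (sum-const K))
    sum-const (outside ∷ K) = trans (idˡ _) (trans (sum-cong-≗ (κ-suc outside K)) (sum-const K))

  pow-n : ∀ x → pow x n ≡ e
  pow-n x = trans (cong (pow x) (sym (Subsetₚ.∣⊤∣≡n n)))
    (pow-∣∣ {⊤} (record { e∈ = Subsetₚ.∈⊤ ; ·∈ = λ _ _ → Subsetₚ.∈⊤ ; inv∈ = λ _ → Subsetₚ.∈⊤ })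
             Subsetₚ.∈⊤)

  nonZero-n : NonZero n
  nonZero-n = nonZero e
    where
    nonZero : ∀ {m} → Fin m → NonZero m
    nonZero {suc m} _ = _

  inv-pow : ∀ x → ∃[ k ] pow x k ≡ inv x
  inv-pow x = go n (pow-n x) nonZero-n
    where
    go : ∀ m → pow x m ≡ e → NonZero m → ∃[ k ] pow x k ≡ inv x
    go (suc m) x^m _ = m , inv-unique x _ x^m

  -- Inverses are powers in a finite group, so closure under `·` suffices and `inv∈` is derived.
  -- Decidability allows maximal subgroups, and elements outside a subgroup, to be found by search.
  record Subgroup : Set₁ where
    field
      Mem  : Pred (Fin n) 0ℓ
      mem? : Decidable Mem
      e∈   : Mem e
      ·∈   : ∀ {x y} → Mem x → Mem y → Mem (x · y)

    pow∈ : ∀ {x} k → Mem x → Mem (pow x k)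
    pow∈ zero    x∈ = e∈
    pow∈ (suc k) x∈ = ·∈ x∈ (pow∈ k x∈)

    inv∈ : ∀ {x} → Mem x → Mem (inv x)
    inv∈ {x} x∈ with k , eq ← inv-pow x = subst Mem eq (pow∈ k x∈)

    cancel∈ˡ : ∀ {x y} → Mem x → Mem (x · y) → Mem y
    cancel∈ˡ {x} {y} x∈ xy∈ = subst Mem
      (trans (sym (assoc _ _ _)) (trans (cong (_· y) (invˡ x)) (idˡ y)))
      (·∈ (inv∈ x∈) xy∈)

    cancel∈ʳ : ∀ {x y} → Mem y → Mem (x · y) → Mem x
    cancel∈ʳ y∈ xy∈ = cancel∈ˡ y∈ (subst Mem (comm _ _) xy∈)

  open Subgroup using (Mem)

  infix 4 _∈_ _∉_
  _∈_ _∉_ : Fin n → Subgroup → Set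
  x ∈ H = Mem H x
  x ∉ H = ¬ x ∈ H

  infixl 6 _⟨_⟩
  -- Membership asks for a power of `g` that moves `x` into `H`, not for a factorisation: only an
  -- exponent has to be searched, and `pow-n` bounds it by `n`. The product form is recovered in
  -- `⟨⟩-elim`.
  _⟨_⟩ : Subgroup → Fin n → Subgroup
  H ⟨ g ⟩ = record
    { Mem  = λ x → ∃[ k ] pow g k · x ∈ H
    ; mem? = λ x → map′ (λ (k , m) → toℕ k , m) (λ (k , m) → reduce k m)
                        (any? (λ k → mem? (pow g (toℕ k) · x)))
    ; e∈   = 0 , subst Mem′ (sym (idˡ e)) e∈
    ; ·∈   = λ {x} {y} (k , m) (l , m′) → k + l , subst Mem′ (shuffle k l x y) (·∈ m m′)
    }
    where
    open Subgroup H renaming (Mem to Mem′)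
    instance _ = nonZero-n
    reduce : ∀ k {x} → Mem′ (pow g k · x) → ∃[ i ] Mem′ (pow g (toℕ {n} i) · x)
    reduce k {x} m = fromℕ< (m%n<n k n) , subst (λ w → Mem′ (w · x))
      (sym (trans (cong (pow g) (Finₚ.toℕ-fromℕ< (m%n<n k n))) (pow-% (pow-n g) k))) m
    shuffle : ∀ k l x y → (pow g k · x) · (pow g l · y) ≡ pow g (k + l) · (x · y)
    shuffle k l x y = trans
      (solve 4 (λ a x b y → (a ⊕ x) ⊕ (b ⊕ y) ⊜ (a ⊕ b) ⊕ (x ⊕ y)) refl _ _ _ _)
      (cong (_· (x · y)) (sym (pow-+ g k l)))

  ⟨⟩-⊇ : ∀ H g {x} → x ∈ H → x ∈ H ⟨ g ⟩
  ⟨⟩-⊇ H g x∈H = 0 , subst (Mem H) (sym (idˡ _)) x∈H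

  g∈⟨g⟩ : ∀ H g → g ∈ H ⟨ g ⟩
  g∈⟨g⟩ H g with k , eq ← inv-pow g =
    k , subst (Mem H) (sym (trans (cong (_· g) eq) (invˡ g))) (Subgroup.e∈ H)

  ⟨⟩-mono : ∀ {H K} g → (∀ {x} → x ∈ H → x ∈ K) → ∀ {x} → x ∈ H ⟨ g ⟩ → x ∈ K ⟨ g ⟩
  ⟨⟩-mono g H⊆K (k , m) = k , H⊆K m

  ⟨⟩-elim : ∀ H g {x} → x ∈ H ⟨ g ⟩ → ∃[ h ] (h ∈ H × ∃[ k ] x ≡ h · pow g k)
  ⟨⟩-elim H g {x} (k , m) with l , eq ← inv-pow (pow g k) = _ , m , k * l , sym (begin
    pow g k · x · pow g (k * l)    ≡⟨ cong (pow g k · x ·_) (trans (pow-* g k l) eq) ⟩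
    pow g k · x · inv (pow g k)    ≡⟨ cong (_· inv (pow g k)) (comm (pow g k) x) ⟩
    x · pow g k · inv (pow g k)    ≡⟨ assoc _ _ _ ⟩
    x · (pow g k · inv (pow g k))  ≡⟨ cong (x ·_) (invʳ _) ⟩
    x · e                          ≡⟨ idʳ x ⟩
    x                              ∎)

  trivial : Subgroup
  trivial = record
    { Mem = _≡ e ; mem? = λ x → x Finₚ.≟ e ; e∈ = refl
    ; ·∈ = λ { refl refl → idˡ e } }

  -- As Good is monotone, one pass through the elements of G suffices.
  saturate : ∀ {a} {State : Set a} {_⊑_ : State → State → Set} {Good : Fin n → State → Set} →
    (∀ {s} → s ⊑ s) → (∀ {s t u} → s ⊑ t → t ⊑ u → s ⊑ u) →
    (∀ {g s t} → s ⊑ t → Good g s → Good g t) →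
    (∀ g s → ∃[ t ] (s ⊑ t × Good g t)) →
    ∀ s → ∃[ t ] (s ⊑ t × (∀ g → Good g t))
  saturate {_} {State} {_⊑_} {Good} ⊑-refl ⊑-trans mono step = loop (λ i → i)
    where
    loop : ∀ {m} (f : Fin m → Fin n) (s : State) → ∃[ t ] (s ⊑ t × (∀ i → Good (f i) t))
    loop {zero}  f s = s , ⊑-refl , λ ()
    loop {suc m} f s with step (f Fin.zero) s
    ... | t , s⊑t , good with loop (f ∘ Fin.suc) t
    ... | u , t⊑u , goods = u , ⊑-trans s⊑t t⊑u ,
      λ { Fin.zero → mono t⊑u good ; (Fin.suc i) → goods i }

-- Arithmetic at an odd prime.

prime-coprime : ∀ {p d} → Prime p → ¬ p ∣ d → Coprime d p
prime-coprime pr p∤d (k∣d , k∣p) with prime⇒irreducible pr k∣p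
... | inj₁ k≡1 = k≡1
... | inj₂ refl = ⊥-elim (p∤d k∣d)

-- This is (t choose 2), the coefficient of the square of the nilpotent part of φ in its t-th power.
tri : ℕ → ℕ
tri zero    = 0
tri (suc t) = t + tri t

2*tri : ∀ t → 2 * tri (suc t) ≡ t * suc t
2*tri zero    = refl
2*tri (suc t) = begin
  2 * (suc t + tri (suc t))       ≡⟨ ℕₚ.*-distribˡ-+ 2 (suc t) (tri (suc t)) ⟩
  2 * suc t + 2 * tri (suc t)     ≡⟨ cong (2 * suc t +_) (2*tri t) ⟩
  2 * suc t + t * suc t           ≡⟨ eq t ⟩
  suc t * suc (suc t)             ∎
  where
  eq : ∀ t → 2 * suc t + t * suc t ≡ suc t * suc (suc t)
  eq = solve-∀

odd-prime-∣-tri : ∀ {q} → Prime (3 + q) → 3 + q ∣ tri (3 + q)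
odd-prime-∣-tri {q} pr with euclidsLemma 2 (tri (3 + q)) pr (divides (2 + q) (2*tri (2 + q)))
... | inj₂ p∣tri = p∣tri
... | inj₁ p∣2 with ∣⇒≤ p∣2
... | s≤s (s≤s ())

-- Elements of order p and characters to ℤ/p.

module PrimeExponent (G : FiniteAbelianGroup) (q : ℕ) (prime : Prime (3 + q)) where
  open GroupTheory G public

  p : ℕ
  p = 3 + q

  pow≡e⇒∣ : ∀ {z d} → pow z p ≡ e → z ≢ e → pow z d ≡ e → p ∣ d
  pow≡e⇒∣ {z} {d} z^p z≢e z^d with p ∣? d
  ... | yes p∣d = p∣d
  ... | no p∤d with s , eq ← pow-coprime (prime-coprime prime p∤d) z^p =
    ⊥-elim (z≢e (trans (sym eq) (trans (cong (λ w → pow w s) z^d) (pow-e s))))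

  pow-injective : ∀ {z i j} → pow z p ≡ e → z ≢ e → pow z i ≡ pow z j → i % p ≡ j % p
  pow-injective {z} {i} {j} z^p z≢e eq with ℕₚ.≤-total i j
  ... | inj₁ i≤j = sym (go i j i≤j eq)
    where
    go : ∀ i j → i ≤ j → pow z i ≡ pow z j → j % p ≡ i % p
    go i j i≤j eq = trans (cong (_% p) (sym (ℕₚ.m+[n∸m]≡n i≤j)))
      (%-remove-+ʳ i (pow≡e⇒∣ z^p z≢e (cancelˡ (pow z i) (begin
        pow z i · pow z (j ∸ i)   ≡⟨ sym (pow-+ z i (j ∸ i)) ⟩
        pow z (i + (j ∸ i))       ≡⟨ cong (pow z) (ℕₚ.m+[n∸m]≡n i≤j) ⟩
        pow z j                   ≡⟨ sym eq ⟩
        pow z i                   ≡⟨ sym (idʳ _) ⟩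
        pow z i · e               ∎))))
  ... | inj₂ j≤i = trans (cong (_% p) (sym (ℕₚ.m+[n∸m]≡n j≤i)))
      (%-remove-+ʳ j (pow≡e⇒∣ z^p z≢e (cancelˡ (pow z j) (begin
        pow z j · pow z (i ∸ j)   ≡⟨ sym (pow-+ z j (i ∸ j)) ⟩
        pow z (j + (i ∸ j))       ≡⟨ cong (pow z) (ℕₚ.m+[n∸m]≡n j≤i) ⟩
        pow z i                   ≡⟨ eq ⟩
        pow z j                   ≡⟨ sym (idʳ _) ⟩
        pow z j · e               ∎))))

  -- If the exponents of `c` differed by some d prime to p, then `pow c d` would lie in ⟨z⟩, and so
  -- would `c`, which is a power of `pow c d`.
  independent : ∀ {c z} → pow c p ≡ e → (∀ j → c ≢ pow z j) →
    ∀ {i j k l} → pow c i · pow z j ≡ pow c k · pow z l → i % p ≡ k % p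
  independent {c} {z} c^p c∉z {i} {j} {k} {l} eq =
    [ (λ i≤k → sym (go {i} {j} {k} {l} i≤k eq)) , (λ k≤i → go {k} {l} {i} {j} k≤i (sym eq)) ]′ (ℕₚ.≤-total i k)
    where
    go : ∀ {i j k l} → i ≤ k → pow c i · pow z j ≡ pow c k · pow z l → k % p ≡ i % p
    go {i} {j} {k} {l} i≤k eq with inv-pow (pow z l)
    ... | m , z^lm = trans (cong (_% p) (sym i+d)) (%-remove-+ʳ i p∣d)
      where
      d = k ∸ i
      i+d = ℕₚ.m+[n∸m]≡n i≤k
      z^j : pow z j ≡ pow c d · pow z l
      z^j = cancelˡ (pow c i) (begin
        pow c i · pow z j                 ≡⟨ eq ⟩
        pow c k · pow z l                 ≡⟨ cong (λ m → pow c m · pow z l) (sym i+d) ⟩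
        pow c (i + d) · pow z l           ≡⟨ cong (_· pow z l) (pow-+ c i d) ⟩
        pow c i · pow c d · pow z l       ≡⟨ assoc _ _ _ ⟩
        pow c i · (pow c d · pow z l)     ∎)
      c^d : pow c d ≡ pow z (j + l * m)
      c^d = begin
        pow c d                                 ≡⟨ sym (idʳ _) ⟩
        pow c d · e                             ≡⟨ cong (pow c d ·_) (sym (invʳ (pow z l))) ⟩
        pow c d · (pow z l · inv (pow z l))     ≡⟨ sym (assoc _ _ _) ⟩
        pow c d · pow z l · inv (pow z l)       ≡⟨ cong₂ _·_ (sym z^j) (trans (sym z^lm) (sym (pow-* z l m))) ⟩
        pow z j · pow z (l * m)                 ≡⟨ sym (pow-+ z j (l * m)) ⟩
        pow z (j + l * m)                       ∎
      p∣d : p ∣ d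
      p∣d with p ∣? d
      ... | yes p∣d = p∣d
      ... | no p∤d with s , c^ds ← pow-coprime (prime-coprime prime p∤d) c^p =
        ⊥-elim (c∉z ((j + l * m) * s) (begin
          c                           ≡⟨ sym c^ds ⟩
          pow (pow c d) s             ≡⟨ cong (λ w → pow w s) c^d ⟩
          pow (pow z (j + l * m)) s   ≡⟨ sym (pow-* z (j + l * m) s) ⟩
          pow z ((j + l * m) * s)     ∎))

  -- A homomorphism G → ℤ/p, with values represented by 0, …, p - 1.
  record Character : Set where
    field
      value   : Fin n → ℕ
      bounded : ∀ x → value x < p
      homo    : ∀ x y → value (x · y) ≡ (value x + value y) % p
      homo-e  : value e ≡ 0

    value-% : ∀ x → value x % p ≡ value x
    value-% x = m<n⇒m%n≡m (bounded x)

    value-0ʳ : ∀ x {y} → value y ≡ 0 → value (x · y) ≡ value x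
    value-0ʳ x {y} y₀ = begin
      value (x · y)            ≡⟨ homo x y ⟩
      (value x + value y) % p  ≡⟨ cong (λ k → (value x + k) % p) y₀ ⟩
      (value x + 0) % p        ≡⟨ cong (_% p) (ℕₚ.+-identityʳ (value x)) ⟩
      value x % p              ≡⟨ value-% x ⟩
      value x                  ∎

    value-0ˡ : ∀ {x} y → value x ≡ 0 → value (x · y) ≡ value y
    value-0ˡ y x₀ = trans (cong value (comm _ y)) (value-0ʳ y x₀)

    value-pow : ∀ x k → value (pow x k) ≡ (k * value x) % p
    value-pow x zero    = homo-e
    value-pow x (suc k) = begin
      value (x · pow x k)                           ≡⟨ homo x (pow x k) ⟩
      (value x + value (pow x k)) % p               ≡⟨ cong₂ (λ i j → (i + j) % p) (sym (value-% x)) (value-pow x k) ⟩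
      (value x % p + (k * value x) % p) % p         ≡⟨ sym (%-distribˡ-+ (value x) (k * value x) p) ⟩
      (value x + k * value x) % p                   ∎

    value-pow-0 : ∀ {x} k → value x ≡ 0 → value (pow x k) ≡ 0
    value-pow-0 {x} k x₀ =
      trans (value-pow x k) (cong (_% p) (trans (cong (k *_) x₀) (ℕₚ.*-zeroʳ k)))

  -- The endomorphism x ↦ c^ψ(x) z^ω(x) is nilpotent of order 3 if c = b, and of order 2
  -- if ω c = 0; in both cases 1 + it is an automorphism of order p.
  record Twist : Set where
    field
      a b c z : Fin n
      ψ ω : Character
    open Character ψ public using () renaming (value to ψ[_])
    open Character ω public using () renaming (value to ω[_])
    field
      ψa : ψ[ a ] ≡ 1
      ωa : ω[ a ] ≡ 0
      ψb : ψ[ b ] ≡ 0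
      ωb : ω[ b ] ≡ 1
      ψc : ψ[ c ] ≡ 0
      ψz : ψ[ z ] ≡ 0
      ωz : ω[ z ] ≡ 0
      c-type : c ≡ b ⊎ ω[ c ] ≡ 0
      c^p  : pow c p ≡ e
      z^p  : pow z p ≡ e
      z≢e  : z ≢ e
      c∉⟨z⟩ : ∀ j → c ≢ pow z j

  -- The automorphism φ and its powers.

  module Twisted (twist : Twist) where
    open Twist twist public
    module ψₕ = Character ψ
    module ωₕ = Character ω

    φ : Fin n → Fin n
    φ x = x · (pow c ψ[ x ] · pow z ω[ x ])

    Φ : ℕ → Fin n → Fin n
    Φ zero    x = x
    Φ (suc t) x = φ (Φ t x)

    φ-· : ∀ x y → φ (x · y) ≡ φ x · φ y
    φ-· x y = begin
      x · y · (pow c ψ[ x · y ] · pow z ω[ x · y ])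
        ≡⟨ cong₂ (λ u v → x · y · (u · v)) (split ψ[ x ] ψ[ y ] c^p (ψₕ.homo x y)) (split ω[ x ] ω[ y ] z^p (ωₕ.homo x y)) ⟩
      x · y · ((pow c ψ[ x ] · pow c ψ[ y ]) · (pow z ω[ x ] · pow z ω[ y ]))
        ≡⟨ solve 6 (λ x y u v r s → (x ⊕ y) ⊕ ((u ⊕ v) ⊕ (r ⊕ s)) ⊜ (x ⊕ (u ⊕ r)) ⊕ (y ⊕ (v ⊕ s)))
             refl x y _ _ _ _ ⟩
      φ x · φ y ∎
      where
      split : ∀ {w k} i j → pow w p ≡ e → k ≡ (i + j) % p → pow w k ≡ pow w i · pow w j
      split {w} i j w^p refl = trans (pow-% w^p (i + j)) (pow-+ w i j)

    ψ-φ : ∀ x → ψ[ φ x ] ≡ ψ[ x ]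
    ψ-φ x = ψₕ.value-0ʳ x (trans (ψₕ.value-0ʳ _ (ψₕ.value-pow-0 ω[ x ] ψz)) (ψₕ.value-pow-0 ψ[ x ] ψc))

    φ-fix : ∀ {x} → ψ[ x ] ≡ 0 → ω[ x ] ≡ 0 → φ x ≡ x
    φ-fix {x} ψx ωx =
      trans (cong₂ (λ i j → x · (pow c i · pow z j)) ψx ωx) (trans (cong (x ·_) (idˡ e)) (idʳ x))

    φz : φ z ≡ z
    φz = φ-fix ψz ωz

    φb : φ b ≡ z · b
    φb = trans (cong₂ (λ i j → b · (pow c i · pow z j)) ψb ωb)
      (trans (cong (b ·_) (trans (idˡ _) (idʳ z))) (comm b z))

    φa : φ a ≡ a · c
    φa = trans (cong₂ (λ i j → a · (pow c i · pow z j)) ψa ωa)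
      (cong (a ·_) (trans (idʳ _) (idʳ c)))

    Φ-· : ∀ t x y → Φ t (x · y) ≡ Φ t x · Φ t y
    Φ-· zero    x y = refl
    Φ-· (suc t) x y = trans (cong φ (Φ-· t x y)) (φ-· _ _)

    Φ-+ : ∀ s t x → Φ (s + t) x ≡ Φ s (Φ t x)
    Φ-+ zero    t x = refl
    Φ-+ (suc s) t x = cong φ (Φ-+ s t x)

    ψ-Φ : ∀ t x → ψ[ Φ t x ] ≡ ψ[ x ]
    ψ-Φ zero    x = refl
    ψ-Φ (suc t) x = trans (ψ-φ _) (ψ-Φ t x)

    Φ-closed : ∀ {S : Pred (Fin n) 0ℓ} → (∀ {x} → S x → S (φ x)) → ∀ t {x} → S x → S (Φ t x)
    Φ-closed φ-S zero    Sx = Sx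
    Φ-closed {S} φ-S (suc t) Sx = φ-S (Φ-closed {S} φ-S t Sx)

    Φ-fix : ∀ t {x} → φ x ≡ x → Φ t x ≡ x
    Φ-fix zero    eq = refl
    Φ-fix (suc t) eq = trans (cong φ (Φ-fix t eq)) eq

    ω-Φ : ∀ t x → ω[ Φ t x ] ≡ (ω[ x ] + t * (ψ[ x ] * ω[ c ])) % p
    ω-Φ zero    x = sym (trans (cong (_% p) (ℕₚ.+-identityʳ ω[ x ])) (ωₕ.value-% x))
    ω-Φ (suc t) x = begin
      ω[ y · (pow c ψ[ y ] · pow z ω[ y ]) ]
        ≡⟨ ωₕ.homo y _ ⟩
      (ω[ y ] + ω[ pow c ψ[ y ] · pow z ω[ y ] ]) % p
        ≡⟨ cong₂ (λ i j → (i + j) % p) (ω-Φ t x)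
             (trans (ωₕ.value-0ʳ _ (ωₕ.value-pow-0 ω[ y ] ωz)) (ωₕ.value-pow c ψ[ y ])) ⟩
      ((ω[ x ] + t * X) % p + (ψ[ y ] * ω[ c ]) % p) % p
        ≡⟨ sym (%-distribˡ-+ (ω[ x ] + t * X) (ψ[ y ] * ω[ c ]) p) ⟩
      (ω[ x ] + t * X + ψ[ y ] * ω[ c ]) % p
        ≡⟨ cong (λ k → (ω[ x ] + t * X + k * ω[ c ]) % p) (ψ-Φ t x) ⟩
      (ω[ x ] + t * X + X) % p
        ≡⟨ cong (_% p) (trans (+-assoc ω[ x ] (t * X) X) (cong (ω[ x ] +_) (+-comm (t * X) X))) ⟩
      (ω[ x ] + suc t * X) % p ∎
      where
      y = Φ t x
      X = ψ[ x ] * ω[ c ]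

    -- With φ = 1 + N, the binomial expansion stops after the quadratic term: N sends `x` to c^ψ(x)
    -- z^ω(x), its square sends `x` to a power of `z` with exponent ψ(x) ω(c), and N kills `z`.
    Φ-formula : ∀ t x → Φ t x ≡ x · (pow c (t * ψ[ x ]) · pow z (t * ω[ x ] + tri t * (ψ[ x ] * ω[ c ])))
    Φ-formula zero    x = sym (trans (cong (x ·_) (idˡ e)) (idʳ x))
    Φ-formula (suc t) x = begin
      y · (pow c ψ[ y ] · pow z ω[ y ])
        ≡⟨ cong₂ (λ u v → y · (u · v)) (cong (pow c) (ψ-Φ t x))
             (trans (cong (pow z) (ω-Φ t x)) (pow-% z^p (ω[ x ] + t * X))) ⟩
      y · (pow c ψ[ x ] · pow z (ω[ x ] + t * X))
        ≡⟨ cong (_· (pow c ψ[ x ] · pow z (ω[ x ] + t * X))) (Φ-formula t x) ⟩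
      x · (pow c (t * ψ[ x ]) · pow z (t * ω[ x ] + tri t * X)) · (pow c ψ[ x ] · pow z (ω[ x ] + t * X))
        ≡⟨ solve 5 (λ x r s u v → (x ⊕ (r ⊕ s)) ⊕ (u ⊕ v) ⊜ x ⊕ ((u ⊕ r) ⊕ (v ⊕ s))) refl x _ _ _ _ ⟩
      x · ((pow c ψ[ x ] · pow c (t * ψ[ x ])) · (pow z (ω[ x ] + t * X) · pow z (t * ω[ x ] + tri t * X)))
        ≡⟨ cong (x ·_) (cong₂ _·_ (sym (pow-+ c ψ[ x ] (t * ψ[ x ])))
             (trans (sym (pow-+ z (ω[ x ] + t * X) (t * ω[ x ] + tri t * X)))
                    (cong (pow z) (eq ω[ x ] t X (tri t))))) ⟩
      x · (pow c (suc t * ψ[ x ]) · pow z (suc t * ω[ x ] + tri (suc t) * X)) ∎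
      where
      y = Φ t x
      X = ψ[ x ] * ω[ c ]
      eq : ∀ o t X r → o + t * X + (t * o + r * X) ≡ suc t * o + (t + r) * X
      eq = solve-∀

    Φ-p : ∀ x → Φ p x ≡ x
    Φ-p x with odd-prime-∣-tri prime
    ... | divides k eq = trans (Φ-formula p x) (trans (cong (x ·_)
      (trans (cong₂ _·_
        (trans (cong (pow c) (*-comm p ψ[ x ])) (pow-*≡e c^p ψ[ x ]))
        (trans (cong (pow z) (trans (cong (λ r → p * ω[ x ] + r * X) eq) (rearrange p ω[ x ] k X)))
               (pow-*≡e z^p (ω[ x ] + k * X))))
       (idˡ e))) (idʳ x))
      where
      X = ψ[ x ] * ω[ c ]
      rearrange : ∀ p o k X → p * o + k * p * X ≡ (o + k * X) * p
      rearrange = solve-∀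

    Φ-%-≡ : ∀ t x → Φ t x ≡ Φ (t % p) x
    Φ-%-≡ t x = begin
      Φ t x                           ≡⟨ cong (λ t → Φ t x) (m≡m%n+[m/n]*n t p) ⟩
      Φ (t % p + t / p * p) x         ≡⟨ Φ-+ (t % p) (t / p * p) x ⟩
      Φ (t % p) (Φ (t / p * p) x)     ≡⟨ cong (Φ (t % p)) (multiple (t / p)) ⟩
      Φ (t % p) x                     ∎
      where
      multiple : ∀ k → Φ (k * p) x ≡ x
      multiple zero    = refl
      multiple (suc k) = trans (Φ-+ p (k * p) x) (trans (Φ-p _) (multiple k))

    Φ-≡% : ∀ s t → s % p ≡ t % p → ∀ x → Φ s x ≡ Φ t x
    Φ-≡% s t eq x = trans (Φ-%-≡ s x) (trans (cong (λ t → Φ t x) eq) (sym (Φ-%-≡ t x)))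

    -- The exponent 2 + q is −1 modulo p.
    Φ⁻¹ : ℕ → Fin n → Fin n
    Φ⁻¹ t = Φ (t * (2 + q))

    Φ-Φ⁻¹ : ∀ t x → Φ t (Φ⁻¹ t x) ≡ x
    Φ-Φ⁻¹ t x = trans (sym (Φ-+ t (t * (2 + q)) x))
      (Φ-≡% (t + t * (2 + q)) 0 (trans (cong (_% p) (sym (*-suc t (2 + q)))) (m*n%n≡0 t p)) x)

    Φ⁻¹-Φ : ∀ t x → Φ⁻¹ t (Φ t x) ≡ x
    Φ⁻¹-Φ t x = trans (sym (Φ-+ (t * (2 + q)) t x))
      (trans (cong (λ s → Φ s x) (+-comm (t * (2 + q)) t)) (trans (Φ-+ t _ x) (Φ-Φ⁻¹ t x)))

    Φ-b : ∀ t → Φ t b ≡ pow z t · b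
    Φ-b zero    = sym (idˡ b)
    Φ-b (suc t) = begin
      φ (Φ t b)              ≡⟨ cong φ (Φ-b t) ⟩
      φ (pow z t · b)        ≡⟨ φ-· _ b ⟩
      φ (pow z t) · φ b      ≡⟨ cong₂ _·_ (φ-fix (ψₕ.value-pow-0 t ψz) (ωₕ.value-pow-0 t ωz)) φb ⟩
      pow z t · (z · b)      ≡⟨ solve 3 (λ u z b → u ⊕ (z ⊕ b) ⊜ (z ⊕ u) ⊕ b) refl (pow z t) z b ⟩
      pow z (suc t) · b      ∎

    Φ-ab : ∀ t → Φ t (a · b) ≡ Φ t a · (pow z t · b)
    Φ-ab t = trans (Φ-· t a b) (cong (Φ t a ·_) (Φ-b t))

    -- The element `Φ t a` lies in the coset of ⟨z⟩ through a c^t, and by `independent` these cosets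
    -- are distinct for distinct residues of t. So the orbit of `a` meets each coset of ⟨z⟩ at most
    -- once.
    Φ-a-distinct : ∀ s t i j → Φ s a · pow z i ≡ Φ t a · pow z j →
                   s % p ≡ t % p × pow z i ≡ pow z j
    Φ-a-distinct s t i j eq = s≡t , cancelˡ (Φ s a) (trans eq (cong (_· pow z j) (sym (Φ-≡% s t s≡t a))))
      where
      expand : ∀ t j → Φ t a · pow z j ≡ a · (pow c t · pow z (tri t * (1 * ω[ c ]) + j))
      expand t j = begin
        Φ t a · pow z j
          ≡⟨ cong (_· pow z j) (Φ-formula t a) ⟩
        a · (pow c (t * ψ[ a ]) · pow z (t * ω[ a ] + tri t * (ψ[ a ] * ω[ c ]))) · pow z j
          ≡⟨ cong₂ (λ k l → a · (pow c k · pow z l) · pow z j)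
               (trans (cong (t *_) ψa) (ℕₚ.*-identityʳ t))
               (cong₂ (λ k l → t * k + tri t * (l * ω[ c ])) ωa ψa) ⟩
        a · (pow c t · pow z (t * 0 + tri t * (1 * ω[ c ]))) · pow z j
          ≡⟨ cong (λ k → a · (pow c t · pow z (k + tri t * (1 * ω[ c ]))) · pow z j) (ℕₚ.*-zeroʳ t) ⟩
        a · (pow c t · pow z (tri t * (1 * ω[ c ]))) · pow z j
          ≡⟨ solve 4 (λ a u v w → (a ⊕ (u ⊕ v)) ⊕ w ⊜ a ⊕ (u ⊕ (v ⊕ w))) refl a _ _ _ ⟩
        a · (pow c t · (pow z (tri t * (1 * ω[ c ])) · pow z j))
          ≡⟨ cong (λ w → a · (pow c t · w)) (sym (pow-+ z (tri t * (1 * ω[ c ])) j)) ⟩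
        a · (pow c t · pow z (tri t * (1 * ω[ c ]) + j)) ∎
      s≡t : s % p ≡ t % p
      s≡t = independent c^p c∉⟨z⟩ {s} {tri s * (1 * ω[ c ]) + i} {t} {tri t * (1 * ω[ c ]) + j}
        (cancelˡ a (trans (sym (expand s i)) (trans eq (expand t j))))

-- Automorphisms of Cayley digraphs and common out-neighbours.

module CayleyAutomorphisms (G : FiniteAbelianGroup) where
  open GroupTheory G

  -- Arcs are written from `u` to `s · u` with label `s`, and the label of the image is existential.
  -- This avoids quotients and makes the notion symmetric in `α` and `β`, so each result also holds
  -- for the inverse through `reverse`.
  record Automorphism (S : Pred (Fin n) 0ℓ) (α β : Fin n → Fin n) : Set where
    field
      β∘α : ∀ x → β (α x) ≡ x
      α∘β : ∀ x → α (β x) ≡ x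
      forward  : ∀ {s} u → S s → ∃[ t ] (S t × α (s · u) ≡ t · α u)
      backward : ∀ {s} u → S s → ∃[ t ] (S t × β (s · u) ≡ t · β u)

    injective : ∀ {x y} → α x ≡ α y → x ≡ y
    injective {x} {y} eq = trans (sym (β∘α x)) (trans (cong β eq) (β∘α y))

  reverse : ∀ {S α β} → Automorphism S α β → Automorphism S β α
  reverse aut = record { β∘α = α∘β ; α∘β = β∘α ; forward = backward ; backward = forward }
    where open Automorphism aut

  -- The endpoints u and s u of an arc have the common out-neighbours w = t (s u) with
  -- t and t s in S.
  Common : Pred (Fin n) 0ℓ → Fin n → Fin n → Set
  Common S s t = S t × S (t · s)

  TwoCommon ThreeCommon : Pred (Fin n) 0ℓ → Fin n → Set
  TwoCommon S s = ∃[ t ] ∃[ t′ ] (t ≢ t′ × Common S s t × Common S s t′)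
  ThreeCommon S s = ∃[ t ] ∃[ t′ ] ∃[ t″ ]
    (t ≢ t′ × t ≢ t″ × t′ ≢ t″ × Common S s t × Common S s t′ × Common S s t″)

  module _ {S α β} (aut : Automorphism S α β) where
    open Automorphism aut

    common-image : ∀ {s s′ t} u → α (s · u) ≡ s′ · α u → Common S s t →
                   ∃[ t′ ] (Common S s′ t′ × α (t · (s · u)) ≡ t′ · α (s · u))
    common-image {s} {s′} {t} u eq (St , Sts) with forward (s · u) St | forward u Sts
    ... | t₁ , St₁ , eq₁ | t₂ , St₂ , eq₂ = t₁ , (St₁ , subst S (cancelʳ (α u) (begin
      t₂ · α u           ≡⟨ sym eq₂ ⟩
      α (t · s · u)      ≡⟨ cong α (assoc t s u) ⟩
      α (t · (s · u))    ≡⟨ eq₁ ⟩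
      t₁ · α (s · u)     ≡⟨ cong (t₁ ·_) eq ⟩
      t₁ · (s′ · α u)    ≡⟨ sym (assoc _ _ _) ⟩
      t₁ · s′ · α u      ∎)) St₂) , eq₁

    distinct-image : ∀ {v t t′ r r′} → t ≢ t′ → α (t · v) ≡ r · α v → α (t′ · v) ≡ r′ · α v → r ≢ r′
    distinct-image {v} t≢t′ eq eq′ refl = t≢t′ (cancelʳ v (injective (trans eq (sym eq′))))

    twoCommon-image : ∀ {s s′} u → α (s · u) ≡ s′ · α u → TwoCommon S s → TwoCommon S s′
    twoCommon-image u eq (t , t′ , t≢t′ , C , C′)
      with common-image u eq C | common-image u eq C′
    ... | r , D , eqr | r′ , D′ , eqr′ = r , r′ , distinct-image t≢t′ eqr eqr′ , D , D′

    threeCommon-image : ∀ {s s′} u → α (s · u) ≡ s′ · α u → ThreeCommon S s → ThreeCommon S s′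
    threeCommon-image u eq (t , t′ , t″ , t≢t′ , t≢t″ , t′≢t″ , C , C′ , C″)
      with common-image u eq C | common-image u eq C′ | common-image u eq C″
    ... | r , D , eqr | r′ , D′ , eqr′ | r″ , D″ , eqr″ =
      r , r′ , r″ , distinct-image t≢t′ eqr eqr′ , distinct-image t≢t″ eqr eqr″ ,
      distinct-image t′≢t″ eqr′ eqr″ , D , D′ , D″

    reverse-arc : ∀ {s s′} u → α (s · u) ≡ s′ · α u → β (s′ · α u) ≡ s · β (α u)
    reverse-arc {s} u eq =
      trans (cong β (sym eq)) (trans (β∘α _) (cong (s ·_) (sym (β∘α u))))

  twoCommon-preimage : ∀ {S α β} → Automorphism S α β → ∀ {s s′} u → α (s · u) ≡ s′ · α u →
                       TwoCommon S s′ → TwoCommon S s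
  twoCommon-preimage {α = α} aut u eq = twoCommon-image (reverse aut) (α u) (reverse-arc aut u eq)

  threeCommon-preimage : ∀ {S α β} → Automorphism S α β → ∀ {s s′} u → α (s · u) ≡ s′ · α u →
                         ThreeCommon S s′ → ThreeCommon S s
  threeCommon-preimage {α = α} aut u eq = threeCommon-image (reverse aut) (α u) (reverse-arc aut u eq)

-- The connection set on ⟨a, b, c, z⟩ and its arc types.

module TwistedDigraphs (G : FiniteAbelianGroup) (q : ℕ) (prime : Prime (3 + q))
  (twist : PrimeExponent.Twist G q prime) where
  open PrimeExponent G q prime public
  open Twisted twist public
  open CayleyAutomorphisms G public

  z²≢e : pow z 2 ≢ e
  z²≢e eq with () ← pow-injective {z} {2} {0} z^p z≢e eq

  Orbit : Fin n → Pred (Fin n) 0ℓ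
  Orbit y x = ∃[ t ] x ≡ Φ t y

  orbit? : ∀ y → Decidable (Orbit y)
  orbit? y x = map′ (λ (i , eq) → toℕ i , eq) (λ (t , eq) → fromℕ< (m%n<n t p) ,
      trans eq (trans (Φ-%-≡ t y) (cong (λ t → Φ t y) (sym (Finₚ.toℕ-fromℕ< (m%n<n t p))))))
    (any? λ i → x Finₚ.≟ Φ (toℕ i) y)

  -- The union `A` is what counting can see: its two orbits are equal if `c ≡ b`, and have ω-values
  -- 0 and 1 if `ω[ c ] ≡ 0`.
  A S₀ : Pred (Fin n) 0ℓ
  A x = Orbit a x ⊎ Orbit (a · b) x
  S₀ x = x ≡ z ⊎ Orbit b x ⊎ A x

  S₀? : Decidable S₀
  S₀? x = x Finₚ.≟ z ⊎-dec orbit? b x ⊎-dec orbit? a x ⊎-dec orbit? (a · b) x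

  φ-orbit : ∀ {x y} → Orbit y x → Orbit y (φ x)
  φ-orbit (t , refl) = suc t , refl

  φ-S₀ : ∀ {x} → S₀ x → S₀ (φ x)
  φ-S₀ (inj₁ refl)               = inj₁ φz
  φ-S₀ (inj₂ (inj₁ o))           = inj₂ (inj₁ (φ-orbit o))
  φ-S₀ (inj₂ (inj₂ (inj₁ o)))    = inj₂ (inj₂ (inj₁ (φ-orbit o)))
  φ-S₀ (inj₂ (inj₂ (inj₂ o)))    = inj₂ (inj₂ (inj₂ (φ-orbit o)))

  ψ-orbit : ∀ {x y} → Orbit y x → ψ[ x ] ≡ ψ[ y ]
  ψ-orbit (t , refl) = ψ-Φ t _

  ψ-A : ∀ {x} → A x → ψ[ x ] ≡ 1
  ψ-A (inj₁ o) = trans (ψ-orbit o) ψa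
  ψ-A (inj₂ o) = trans (ψ-orbit o) (trans (ψₕ.value-0ʳ a ψb) ψa)

  ψ-b : ∀ {x} → Orbit b x → ψ[ x ] ≡ 0
  ψ-b o = trans (ψ-orbit o) ψb

  ω-b : ∀ {x} → Orbit b x → ω[ x ] ≡ 1
  ω-b (t , refl) = trans (cong ω[_] (Φ-b t)) (trans (ωₕ.value-0ˡ b (ωₕ.value-pow-0 t ωz)) ωb)

  ψ-+ : ∀ {x y i j} → ψ[ x ] ≡ i → ψ[ y ] ≡ j → ψ[ x · y ] ≡ (i + j) % p
  ψ-+ {x} {y} refl refl = ψₕ.homo x y

  ω-+ : ∀ {x y i j} → ω[ x ] ≡ i → ω[ y ] ≡ j → ω[ x · y ] ≡ (i + j) % p
  ω-+ {x} {y} refl refl = ωₕ.homo x y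

  S₀-ψ≡0 : ∀ {x} → S₀ x → ψ[ x ] ≡ 0 → x ≡ z ⊎ Orbit b x
  S₀-ψ≡0 (inj₁ x≡z)        _  = inj₁ x≡z
  S₀-ψ≡0 (inj₂ (inj₁ o))   _  = inj₂ o
  S₀-ψ≡0 (inj₂ (inj₂ Ax)) ψx with () ← trans (sym ψx) (ψ-A Ax)

  S₀-ψ≡1 : ∀ {x} → S₀ x → ψ[ x ] ≡ 1 → A x
  S₀-ψ≡1 (inj₁ refl)      ψx with () ← trans (sym ψx) ψz
  S₀-ψ≡1 (inj₂ (inj₁ o))  ψx with () ← trans (sym ψx) (ψ-b o)
  S₀-ψ≡1 (inj₂ (inj₂ Ax)) _  = Ax

  S₀-ψ : ∀ {x} → S₀ x → ψ[ x ] ≡ 0 ⊎ ψ[ x ] ≡ 1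
  S₀-ψ (inj₁ refl)      = inj₁ ψz
  S₀-ψ (inj₂ (inj₁ o))  = inj₁ (ψ-b o)
  S₀-ψ (inj₂ (inj₂ Ax)) = inj₂ (ψ-A Ax)

  S₀-ψ≢2 : ∀ {x} → S₀ x → ψ[ x ] ≢ 2
  S₀-ψ≢2 Sx ψx with S₀-ψ Sx
  ... | inj₁ eq with () ← trans (sym ψx) eq
  ... | inj₂ eq with () ← trans (sym ψx) eq

  S₀-ψω≢02 : ∀ {x} → S₀ x → ψ[ x ] ≡ 0 → ω[ x ] ≢ 2
  S₀-ψω≢02 Sx ψx ωx with S₀-ψ≡0 Sx ψx
  ... | inj₁ refl with () ← trans (sym ωx) ωz
  ... | inj₂ o    with () ← trans (sym ωx) (ω-b o)

  module _ (c≡b : c ≡ b) where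
    Φ-ab-suc : ∀ t → Φ t (a · b) ≡ Φ (suc t) a
    Φ-ab-suc t = trans (cong (Φ t) (trans (cong (a ·_) (sym c≡b)) (sym φa)))
      (trans (sym (Φ-+ t 1 a)) (cong (λ s → Φ s a) (+-comm t 1)))

    orbit-ab⇒a : ∀ {x} → Orbit (a · b) x → Orbit a x
    orbit-ab⇒a (t , refl) = suc t , Φ-ab-suc t

    orbit-a⇒ab : ∀ {x} → Orbit a x → Orbit (a · b) x
    orbit-a⇒ab (t , refl) = t + (2 + q) , sym (begin
      Φ (t + (2 + q)) (a · b)    ≡⟨ Φ-ab-suc (t + (2 + q)) ⟩
      Φ (suc (t + (2 + q))) a    ≡⟨ cong (λ s → Φ s a) (sym (ℕₚ.+-suc t (2 + q))) ⟩
      Φ (t + p) a                ≡⟨ Φ-+ t p a ⟩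
      Φ t (Φ p a)                ≡⟨ cong (Φ t) (Φ-p a) ⟩
      Φ t a                      ∎)

    A⇒a : ∀ {x} → A x → Orbit a x
    A⇒a = [ (λ o → o) , orbit-ab⇒a ]′

    A⇒ab : ∀ {x} → A x → Orbit (a · b) x
    A⇒ab = [ orbit-a⇒ab , (λ o → o) ]′

  module _ (ωc : ω[ c ] ≡ 0) where
    ω-Φ-const : ∀ t x → ω[ Φ t x ] ≡ ω[ x ]
    ω-Φ-const t x = begin
      ω[ Φ t x ]                              ≡⟨ ω-Φ t x ⟩
      (ω[ x ] + t * (ψ[ x ] * ω[ c ])) % p    ≡⟨ cong (λ k → (ω[ x ] + t * (ψ[ x ] * k)) % p) ωc ⟩
      (ω[ x ] + t * (ψ[ x ] * 0)) % p         ≡⟨ cong (λ k → (ω[ x ] + k) % p) (trans (cong (t *_) (ℕₚ.*-zeroʳ ψ[ x ])) (ℕₚ.*-zeroʳ t)) ⟩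
      (ω[ x ] + 0) % p                        ≡⟨ cong (_% p) (ℕₚ.+-identityʳ ω[ x ]) ⟩
      ω[ x ] % p                              ≡⟨ ωₕ.value-% x ⟩
      ω[ x ]                                  ∎

    ω-a : ∀ {x} → Orbit a x → ω[ x ] ≡ 0
    ω-a (t , refl) = trans (ω-Φ-const t a) ωa

    ω-ab : ∀ {x} → Orbit (a · b) x → ω[ x ] ≡ 1
    ω-ab (t , refl) = trans (ω-Φ-const t (a · b)) (trans (ωₕ.value-0ˡ b ωa) ωb)

  -- If `ω[ c ] ≡ 0`, the factor `s` raises ω by 1, and on `A` only the step from 0 to 1 is
  -- possible, 2 being a different residue. If `c ≡ b`, each element of `A` belongs to both orbits.
  A-b-A : ∀ {x y s} → A x → A y → Orbit b s → y ≡ s · x → Orbit a x × Orbit (a · b) y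
  A-b-A Ax Ay ob y≡sx with c-type
  ... | inj₁ c≡b = A⇒a c≡b Ax , A⇒ab c≡b Ay
  ... | inj₂ ωc with Ax | Ay
  ... | inj₁ ox | inj₂ oy = ox , oy
  ... | inj₁ ox | inj₁ oy with () ← trans (sym (ω-a ωc oy)) (trans (cong ω[_] y≡sx) (ω-+ (ω-b ob) (ω-a ωc ox)))
  ... | inj₂ ox | inj₁ oy with () ← trans (sym (ω-a ωc oy)) (trans (cong ω[_] y≡sx) (ω-+ (ω-b ob) (ω-ab ωc ox)))
  ... | inj₂ ox | inj₂ oy with () ← trans (sym (ω-ab ωc oy)) (trans (cong ω[_] y≡sx) (ω-+ (ω-b ob) (ω-ab ωc ox)))

  -- Within the orbit of `a` this is `Φ-a-distinct`. Within the orbit of `a · b` the exponents of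
  -- `c` agree, and the powers of `z` then differ by one factor `z`. Mixed pairs occur only for
  -- `ω[ c ] ≡ 0` and are separated by ω, which `z` does not change.
  A-z-A : ∀ {x y} → A x → A y → y ≢ z · x
  A-z-A Ax Ay y≡zx = case c-type of λ where
      (inj₁ c≡b) → a-a (A⇒a c≡b Ax) (A⇒a c≡b Ay) y≡zx
      (inj₂ ωc)  → split ωc Ax Ay (trans (cong ω[_] y≡zx) (ωₕ.value-0ˡ _ ωz))
    where
    a-a : ∀ {x y} → Orbit a x → Orbit a y → y ≢ z · x
    a-a (s , refl) (t , refl) eq with Φ-a-distinct t s 0 1 (begin
        Φ t a · e            ≡⟨ idʳ _ ⟩
        Φ t a                ≡⟨ eq ⟩
        z · Φ s a            ≡⟨ comm z _ ⟩
        Φ s a · z            ≡⟨ cong (Φ s a ·_) (sym (idʳ z)) ⟩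
        Φ s a · pow z 1      ∎)
    ... | _ , e≡z = z≢e (trans (sym (idʳ z)) (sym e≡z))
    split : ω[ c ] ≡ 0 → A _ → A _ → ω[ _ ] ≡ ω[ _ ] → ⊥
    split ωc (inj₁ ox) (inj₁ oy) _ = a-a ox oy y≡zx
    split ωc (inj₁ ox) (inj₂ oy) eq with () ← trans (sym (ω-ab ωc oy)) (trans eq (ω-a ωc ox))
    split ωc (inj₂ ox) (inj₁ oy) eq with () ← trans (sym (ω-a ωc oy)) (trans eq (ω-ab ωc ox))
    split ωc (inj₂ (s , refl)) (inj₂ (t , refl)) _ with Φ-a-distinct t s t (suc s) (cancelʳ b (begin
        Φ t a · pow z t · b          ≡⟨ assoc _ _ _ ⟩
        Φ t a · (pow z t · b)        ≡⟨ sym (Φ-ab t) ⟩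
        Φ t (a · b)                  ≡⟨ y≡zx ⟩
        z · Φ s (a · b)              ≡⟨ cong (z ·_) (Φ-ab s) ⟩
        z · (Φ s a · (pow z s · b))  ≡⟨ solve 4 (λ z u v b → z ⊕ (u ⊕ (v ⊕ b)) ⊜ (u ⊕ (z ⊕ v)) ⊕ b) refl z _ _ b ⟩
        Φ s a · pow z (suc s) · b    ∎))
    ... | t≡s , eq = z≢e (cancelʳ (pow z s) (begin
        z · pow z s     ≡⟨ sym eq ⟩
        pow z t         ≡⟨ pow-≡% {z} {p} z^p {t} {s} t≡s ⟩
        pow z s         ≡⟨ sym (idˡ _) ⟩
        e · pow z s     ∎))

  -- A triangle with sides of types a, b and ab is the image under one power of φ of the standard
  -- one: the power of `c` compares `t` with `r`, after which the power of `z` compares `t` with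
  -- `i`. Knowing one side therefore determines the other two.
  a-b-ab : ∀ r t i → Φ t (a · b) ≡ Φ i b · Φ r a → t % p ≡ r % p × t % p ≡ i % p
  a-b-ab r t i eq with Φ-a-distinct t r t i (cancelʳ b (begin
      Φ t a · pow z t · b      ≡⟨ assoc _ _ _ ⟩
      Φ t a · (pow z t · b)    ≡⟨ sym (Φ-ab t) ⟩
      Φ t (a · b)              ≡⟨ eq ⟩
      Φ i b · Φ r a            ≡⟨ cong (_· Φ r a) (Φ-b i) ⟩
      pow z i · b · Φ r a      ≡⟨ solve 3 (λ u b v → (u ⊕ b) ⊕ v ⊜ (v ⊕ u) ⊕ b) refl (pow z i) b (Φ r a) ⟩
      Φ r a · pow z i · b      ∎))
  ... | t≡r , z^t≡z^i = t≡r , pow-injective {z} {t} {i} z^p z≢e z^t≡z^i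

  -- Two labels from the orbit of `b` multiply to ψ-value 0 and ω-value 2, which does not occur in
  -- `S₀`. A label from `A` completes a triangle as in `a-b-ab`, which leaves one choice.
  common-b : ∀ i {t} → Common S₀ (Φ i b) t → t ≡ z ⊎ t ≡ Φ i a
  common-b i (inj₁ t≡z , _) = inj₁ t≡z
  common-b i (inj₂ (inj₁ o) , Sts) =
    ⊥-elim (S₀-ψω≢02 Sts (ψ-+ (ψ-b o) (ψ-b (i , refl))) (ω-+ (ω-b o) (ω-b (i , refl))))
  common-b i {t} (inj₂ (inj₂ At) , Sts)
    with A-b-A At (S₀-ψ≡1 Sts (ψ-+ (ψ-A At) (ψ-b (i , refl)))) (i , refl) (comm t _)
  ... | (r , refl) , (k , eq) with a-b-ab r k i (trans (sym eq) (comm _ _))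
  ... | k≡r , k≡i = inj₂ (Φ-≡% r i (trans (sym k≡r) k≡i) a)

  -- Labels with ψ-value 1 are excluded because the product would have ψ-value 2, and `z` is
  -- excluded by `A-z-A`. What remains is a triangle as in `a-b-ab`, whose exponent is that of `s`.
  common-A : ∀ {s t} → A s → Common S₀ s t → ∃[ r ] (s ≡ Φ r a × t ≡ Φ r b)
  common-A {s} {t} As (St , Sts) with S₀-ψ St
  ... | inj₂ ψt = ⊥-elim (S₀-ψ≢2 Sts (ψ-+ ψt (ψ-A As)))
  ... | inj₁ ψt with S₀-ψ≡0 St ψt | S₀-ψ≡1 Sts (ψ-+ ψt (ψ-A As))
  ... | inj₁ refl | Ats = ⊥-elim (A-z-A As Ats refl)
  ... | inj₂ (i , refl) | Ats with A-b-A As Ats (i , refl) refl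
  ... | (r , refl) , (k , eq) with a-b-ab r k i (sym eq)
  ... | k≡r , k≡i = r , refl , Φ-≡% i r (trans (sym k≡i) k≡r) b

  -- The orbit of `b` is the coset of ⟨z⟩ through `b`: multiplication by `z` maps it to itself, and
  -- it has p ≥ 3 elements.
  threeCommon-z : ThreeCommon S₀ z
  threeCommon-z = b , Φ 1 b , Φ 2 b ,
      distinct 0 1 (λ ()) , distinct 0 2 (λ ()) , distinct 1 2 (λ ()) , com 0 , com 1 , com 2
    where
    distinct : ∀ i j → i % p ≢ j % p → Φ i b ≢ Φ j b
    distinct i j i≢j eq = i≢j (pow-injective {z} {i} {j} z^p z≢e
      (cancelʳ b (trans (sym (Φ-b i)) (trans eq (Φ-b j)))))
    com : ∀ i → Common S₀ z (Φ i b)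
    com i = inj₂ (inj₁ (i , refl)) , inj₂ (inj₁ (suc i , (begin
      Φ i b · z            ≡⟨ cong (_· z) (Φ-b i) ⟩
      pow z i · b · z      ≡⟨ solve 3 (λ u b z → (u ⊕ b) ⊕ z ⊜ (z ⊕ u) ⊕ b) refl (pow z i) b z ⟩
      pow z (suc i) · b    ≡⟨ sym (Φ-b (suc i)) ⟩
      Φ (suc i) b          ∎)))

  twoCommon-b : ∀ {s} → Orbit b s → TwoCommon S₀ s
  twoCommon-b (i , refl) = z , Φ i a , z≢a ,
      (inj₁ refl , inj₂ (inj₁ (suc i , zb))) ,
      (inj₂ (inj₂ (inj₁ (i , refl))) , inj₂ (inj₂ (inj₂ (i , sym (Φ-· i a b)))))
    where
    z≢a : z ≢ Φ i a
    z≢a eq with () ← trans (sym ψz) (trans (cong ψ[_] eq) (ψ-A (inj₁ (i , refl))))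
    zb : z · Φ i b ≡ Φ (suc i) b
    zb = trans (cong (z ·_) (Φ-b i)) (trans (sym (assoc _ _ _)) (sym (Φ-b (suc i))))

  ¬threeCommon-b : ∀ {s} → Orbit b s → ¬ ThreeCommon S₀ s
  ¬threeCommon-b (i , refl) (t , t′ , t″ , t≢t′ , t≢t″ , t′≢t″ , C , C′ , C″)
    with common-b i C | common-b i C′ | common-b i C″
  ... | inj₁ p | inj₁ q | _      = t≢t′ (trans p (sym q))
  ... | inj₂ p | inj₂ q | _      = t≢t′ (trans p (sym q))
  ... | inj₁ p | inj₂ _ | inj₁ q = t≢t″ (trans p (sym q))
  ... | inj₂ p | inj₁ _ | inj₂ q = t≢t″ (trans p (sym q))
  ... | inj₁ _ | inj₂ p | inj₂ q = t′≢t″ (trans p (sym q))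
  ... | inj₂ _ | inj₁ p | inj₁ q = t′≢t″ (trans p (sym q))

  ¬twoCommon-A : ∀ {s} → A s → ¬ TwoCommon S₀ s
  ¬twoCommon-A As (t , t′ , t≢t′ , C , C′) with common-A As C | common-A As C′
  ... | r , refl , refl | r′ , eq , refl with Φ-a-distinct r r′ 0 0 (cong (_· e) eq)
  ... | r≡r′ , _ = t≢t′ (Φ-≡% r r′ r≡r′ b)

  threeCommon⇒twoCommon : ∀ {S s} → ThreeCommon S s → TwoCommon S s
  threeCommon⇒twoCommon (t , t′ , _ , t≢t′ , _ , _ , C , C′ , _) = t , t′ , t≢t′ , C , C′

  -- The image of an arc may change its exponent within the orbit, except for `z`, whose orbit is a
  -- single point. No inverse is required, so composition with a power of φ is immediate.
  record PreservesTypes (α : Fin n → Fin n) : Set where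
    field
      z-arc  : ∀ u → α (z · u) ≡ z · α u
      b-arc  : ∀ {s} u → Orbit b s → ∃[ t ] (Orbit b t × α (s · u) ≡ t · α u)
      a-arc  : ∀ {s} u → Orbit a s → ∃[ t ] (Orbit a t × α (s · u) ≡ t · α u)
      ab-arc : ∀ {s} u → Orbit (a · b) s → ∃[ t ] (Orbit (a · b) t × α (s · u) ≡ t · α u)

  module _ {α β} (aut : Automorphism S₀ α β) where
    open Automorphism aut

    z-preserved : ∀ u → α (z · u) ≡ z · α u
    z-preserved u with forward u (inj₁ refl)
    ... | t , inj₁ refl , eq = eq
    ... | t , inj₂ (inj₁ o) , eq =
      ⊥-elim (¬threeCommon-b o (threeCommon-image aut u eq threeCommon-z))
    ... | t , inj₂ (inj₂ At) , eq =
      ⊥-elim (¬twoCommon-A At (twoCommon-image aut u eq (threeCommon⇒twoCommon threeCommon-z)))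

    b-preserved : ∀ {s} u → Orbit b s → ∃[ t ] (Orbit b t × α (s · u) ≡ t · α u)
    b-preserved u o with forward u (inj₂ (inj₁ o))
    ... | t , inj₁ refl , eq =
      ⊥-elim (¬threeCommon-b o (threeCommon-preimage aut u eq threeCommon-z))
    ... | t , inj₂ (inj₁ o′) , eq = t , o′ , eq
    ... | t , inj₂ (inj₂ At) , eq =
      ⊥-elim (¬twoCommon-A At (twoCommon-image aut u eq (twoCommon-b o)))

    A-preserved : ∀ {s} u → A s → ∃[ t ] (A t × α (s · u) ≡ t · α u)
    A-preserved u As with forward u (inj₂ (inj₂ As))
    ... | t , inj₁ refl , eq =
      ⊥-elim (¬twoCommon-A As (twoCommon-preimage aut u eq (threeCommon⇒twoCommon threeCommon-z)))
    ... | t , inj₂ (inj₁ o) , eq =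
      ⊥-elim (¬twoCommon-A As (twoCommon-preimage aut u eq (twoCommon-b o)))
    ... | t , inj₂ (inj₂ At) , eq = t , At , eq

    -- An arc of type a followed by one of type b is an arc of type ab; by A-b-A only
    -- arcs of these types form such a triangle.
    a-ab-preserved : ∀ r u → ∃[ x ] ∃[ y ] (Orbit a x × Orbit (a · b) y ×
      α (Φ r a · u) ≡ x · α u × α (Φ r (a · b) · u) ≡ y · α u)
    a-ab-preserved r u
      with A-preserved u (inj₁ (r , refl)) | A-preserved u (inj₂ (r , refl))
         | b-preserved (Φ r a · u) (r , refl)
    ... | x , Ax , eqx | y , Ay , eqy | s , ob , eqs
      with A-b-A Ax Ay ob (cancelʳ (α u) (begin
        y · α u                      ≡⟨ sym eqy ⟩
        α (Φ r (a · b) · u)          ≡⟨ cong (λ w → α (w · u)) (trans (Φ-· r a b) (comm _ _)) ⟩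
        α (Φ r b · Φ r a · u)        ≡⟨ cong α (assoc _ _ _) ⟩
        α (Φ r b · (Φ r a · u))      ≡⟨ eqs ⟩
        s · α (Φ r a · u)            ≡⟨ cong (s ·_) eqx ⟩
        s · (x · α u)                ≡⟨ sym (assoc _ _ _) ⟩
        s · x · α u                  ∎))
    ... | ox , oy = x , y , ox , oy , eqx , eqy

    preservesTypes : PreservesTypes α
    preservesTypes = record
      { z-arc = z-preserved
      ; b-arc = b-preserved
      ; a-arc = λ { u (r , refl) → let x , y , ox , oy , eqx , eqy = a-ab-preserved r u in x , ox , eqx }
      ; ab-arc = λ { u (r , refl) → let x , y , ox , oy , eqx , eqy = a-ab-preserved r u in y , oy , eqy }
      }

  preservesTypes-Φ : ∀ t {α} → PreservesTypes α → PreservesTypes (Φ t ∘ α)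
  preservesTypes-Φ t {α} P = record
    { z-arc = λ u → trans (cong (Φ t) (z-arc u)) (trans (Φ-· t z _) (cong (_· Φ t (α u)) (Φ-fix t φz)))
    ; b-arc = λ u o → compose (b-arc u o)
    ; a-arc = λ u o → compose (a-arc u o)
    ; ab-arc = λ u o → compose (ab-arc u o)
    }
    where
    open PreservesTypes P
    compose : ∀ {y u v} → ∃[ s ] (Orbit y s × v ≡ s · u) → ∃[ s ] (Orbit y s × Φ t v ≡ s · Φ t u)
    compose {y} (s , (r , refl) , refl) = Φ t s , (t + r , sym (Φ-+ t r y)) , Φ-· t _ _

-- Rigidity on ⟨a, b, c, z⟩ and the tower of subgroups.

module Tower (G : FiniteAbelianGroup) (q : ℕ) (prime : Prime (3 + q))
  (twist : PrimeExponent.Twist G q prime) where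
  open TwistedDigraphs G q prime twist public

  module FixedPoints {α} (preserves : PreservesTypes α) where
    open PreservesTypes preserves

    -- Fixing `x` alone leaves open which element of the orbit of `a` labels the image of the arc to
    -- `a · x`. With both ends fixed, every triangle on this arc has a known side, and `a-b-ab`
    -- settles the rest.
    Fixed : Pred (Fin n) 0ℓ
    Fixed x = α x ≡ x × α (a · x) ≡ a · x

    Closed : Fin n → Set
    Closed g = ∀ {x} → Fixed x → Fixed (g · x)

    closed-· : ∀ {g h} → Closed g → Closed h → Closed (g · h)
    closed-· cg ch Fx = subst Fixed (sym (assoc _ _ _)) (cg (ch Fx))

    closed-e : Closed e
    closed-e = subst Fixed (sym (idˡ _))

    closed-pow : ∀ {g} → Closed g → ∀ k → Closed (pow g k)
    closed-pow cg zero    = closed-e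
    closed-pow cg (suc k) = closed-· cg (closed-pow cg k)

    closed-inv : ∀ {g} → Closed g → Closed (inv g)
    closed-inv {g} cg with k , eq ← inv-pow g = subst Closed eq (closed-pow cg k)

    closed-⟨⟩ : ∀ H g → (∀ {h} → h ∈ H → Closed h) → Closed g → ∀ {h} → h ∈ H ⟨ g ⟩ → Closed h
    closed-⟨⟩ H g cH cg h∈ with ⟨⟩-elim H g h∈
    ... | h , h∈H , k , refl = closed-· (cH h∈H) (closed-pow cg k)

    closed-z : Closed z
    closed-z {x} (x-fix , ax-fix) = trans (z-arc x) (cong (z ·_) x-fix) , (begin
      α (a · (z · x))    ≡⟨ cong α (swap a z) ⟩
      α (z · (a · x))    ≡⟨ z-arc (a · x) ⟩
      z · α (a · x)      ≡⟨ cong (z ·_) ax-fix ⟩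
      z · (a · x)        ≡⟨ swap z a ⟩
      a · (z · x)        ∎)
      where
      swap : ∀ u v → u · (v · x) ≡ v · (u · x)
      swap u v = solve 3 (λ u v x → u ⊕ (v ⊕ x) ⊜ v ⊕ (u ⊕ x)) refl u v x

    -- In the triangle `x`, `a · x`, `a · (b · x)` the side of type a is fixed, so the sides of
    -- types b and ab keep exponent 0.
    abx-fixed : ∀ {x} → Fixed x → α (a · (b · x)) ≡ a · (b · x)
    abx-fixed {x} (x-fix , ax-fix) with b-arc (a · x) (0 , refl) | ab-arc x (0 , refl)
    ... | _ , (i , refl) , eq₁ | _ , (t , refl) , eq₂ = begin
      α (a · (b · x))       ≡⟨ α-ab ⟩
      Φ t (a · b) · α x     ≡⟨ cong₂ _·_ (Φ-≡% t 0 (proj₁ (a-b-ab 0 t i (cancelʳ x key))) (a · b)) x-fix ⟩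
      a · b · x             ≡⟨ assoc _ _ _ ⟩
      a · (b · x)           ∎
      where
      α-ab : α (a · (b · x)) ≡ Φ t (a · b) · α x
      α-ab = trans (cong α (sym (assoc a b x))) eq₂
      key : Φ t (a · b) · x ≡ Φ i b · a · x
      key = begin
        Φ t (a · b) · x       ≡⟨ cong (Φ t (a · b) ·_) (sym x-fix) ⟩
        Φ t (a · b) · α x     ≡⟨ sym α-ab ⟩
        α (a · (b · x))       ≡⟨ cong α (solve 3 (λ a b x → a ⊕ (b ⊕ x) ⊜ b ⊕ (a ⊕ x)) refl a b x) ⟩
        α (b · (a · x))       ≡⟨ eq₁ ⟩
        Φ i b · α (a · x)     ≡⟨ cong (Φ i b ·_) ax-fix ⟩
        Φ i b · (a · x)       ≡⟨ sym (assoc _ _ _) ⟩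
        Φ i b · a · x         ∎

    -- In the triangle `x`, `b · x`, `a · (b · x)` the side of type ab is fixed by `abx-fixed`,
    -- which fixes the middle vertex.
    closed-b : Closed b
    closed-b {x} Fx@(x-fix , _) with b-arc x (0 , refl)
    ... | _ , (j , refl) , eq₁ with a-arc (b · x) (0 , refl)
    ... | _ , (r , refl) , eq₂ =
      trans eq₁ (cong₂ _·_ (Φ-≡% j 0 (sym (proj₂ (a-b-ab r 0 j (cancelʳ x key)))) b) x-fix) , abx-fixed Fx
      where
      key : a · b · x ≡ Φ j b · Φ r a · x
      key = begin
        a · b · x                  ≡⟨ assoc _ _ _ ⟩
        a · (b · x)                ≡⟨ sym (abx-fixed Fx) ⟩
        α (a · (b · x))            ≡⟨ eq₂ ⟩
        Φ r a · α (b · x)          ≡⟨ cong (Φ r a ·_) (trans eq₁ (cong (Φ j b ·_) x-fix)) ⟩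
        Φ r a · (Φ j b · x)        ≡⟨ solve 3 (λ u v x → u ⊕ (v ⊕ x) ⊜ (v ⊕ u) ⊕ x) refl (Φ r a) (Φ j b) x ⟩
        Φ j b · Φ r a · x          ∎

    -- Two triangles at `a · x` are used. The side of type b from `a · x` to `a · (b · x)` is fixed
    -- by `abx-fixed`, which fixes `a · b · (a · x)`. Now the side of type ab from `a · x` to that
    -- vertex is fixed, and the triangle over it through `a · (a · x)` fixes this vertex.
    closed-a : Closed a
    closed-a {x} Fx@(x-fix , ax-fix) with ab-arc (a · x) (0 , refl) | a-arc (a · (b · x)) (0 , refl)
                                        | a-arc (a · x) (0 , refl)
    ... | _ , (t , refl) , eq₁ | _ , (r , refl) , eq₂ | _ , (s , refl) , eq₃
      with b-arc (a · (a · x)) (0 , refl)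
    ... | _ , (j , refl) , eq₄ = ax-fix , (begin
      α (a · (a · x))       ≡⟨ eq₃ ⟩
      Φ s a · α (a · x)     ≡⟨ cong₂ _·_ (Φ-≡% s 0 (sym (proj₁ (a-b-ab s 0 j (cancelʳ (a · x) key₂)))) a) ax-fix ⟩
      a · (a · x)           ∎)
      where
      key₁ : Φ t (a · b) · (a · x) ≡ b · Φ r a · (a · x)
      key₁ = begin
        Φ t (a · b) · (a · x)        ≡⟨ cong (Φ t (a · b) ·_) (sym ax-fix) ⟩
        Φ t (a · b) · α (a · x)      ≡⟨ sym eq₁ ⟩
        α (a · b · (a · x))          ≡⟨ cong α (solve 3 (λ a b x → (a ⊕ b) ⊕ (a ⊕ x) ⊜ a ⊕ (a ⊕ (b ⊕ x))) refl a b x) ⟩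
        α (a · (a · (b · x)))        ≡⟨ eq₂ ⟩
        Φ r a · α (a · (b · x))      ≡⟨ cong (Φ r a ·_) (abx-fixed Fx) ⟩
        Φ r a · (a · (b · x))        ≡⟨ solve 4 (λ u a b x → u ⊕ (a ⊕ (b ⊕ x)) ⊜ (b ⊕ u) ⊕ (a ⊕ x)) refl (Φ r a) a b x ⟩
        b · Φ r a · (a · x)          ∎
      aabx-fixed : α (a · b · (a · x)) ≡ a · b · (a · x)
      aabx-fixed = trans eq₁ (cong₂ _·_
        (Φ-≡% t 0 (proj₂ (a-b-ab r t 0 (cancelʳ (a · x) key₁))) (a · b)) ax-fix)
      key₂ : a · b · (a · x) ≡ Φ j b · Φ s a · (a · x)
      key₂ = begin
        a · b · (a · x)                  ≡⟨ sym aabx-fixed ⟩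
        α (a · b · (a · x))              ≡⟨ cong α (solve 3 (λ a b x → (a ⊕ b) ⊕ (a ⊕ x) ⊜ b ⊕ (a ⊕ (a ⊕ x))) refl a b x) ⟩
        α (b · (a · (a · x)))            ≡⟨ eq₄ ⟩
        Φ j b · α (a · (a · x))          ≡⟨ cong (Φ j b ·_) (trans eq₃ (cong (Φ s a ·_) ax-fix)) ⟩
        Φ j b · (Φ s a · (a · x))        ≡⟨ sym (assoc _ _ _) ⟩
        Φ j b · Φ s a · (a · x)          ∎

    -- The vertex `φ a · x` is also the head of the arc labelled `φ (a · b)` at the vertex `y` with
    -- `x ≡ z · b · y`, because `φ b ≡ z · b`; and `y` is fixed by the closure under `b` and `z`.
    -- Both image arcs end at one vertex: the powers of `c` give equal exponents, the powers of `z`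
    -- show that they are 1.
    acx-fixed : ∀ {x} → Fixed x → α (a · c · x) ≡ a · c · x
    acx-fixed {x} Fx@(x-fix , _) with a-arc x (1 , refl) | ab-arc (inv b · (inv z · x)) (1 , refl)
    ... | _ , (t , refl) , eq₁ | _ , (s , refl) , eq₂ = begin
        α (a · c · x)      ≡⟨ cong (λ w → α (w · x)) (sym φa) ⟩
        α (φ a · x)        ≡⟨ eq₁ ⟩
        Φ t a · α x        ≡⟨ cong₂ _·_ (Φ-≡% t 1 t≡1 a) x-fix ⟩
        φ a · x            ≡⟨ cong (_· x) φa ⟩
        a · c · x          ∎
      where
      y = inv b · (inv z · x)
      x≡zby : x ≡ z · b · y
      x≡zby = sym (begin
        z · b · (inv b · (inv z · x))        ≡⟨ solve 5 (λ z b b⁻ z⁻ x → (z ⊕ b) ⊕ (b⁻ ⊕ (z⁻ ⊕ x)) ⊜ (b ⊕ b⁻) ⊕ ((z ⊕ z⁻) ⊕ x)) refl z b (inv b) (inv z) x ⟩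
        (b · inv b) · ((z · inv z) · x)      ≡⟨ cong₂ (λ u v → u · (v · x)) (invʳ b) (invʳ z) ⟩
        e · (e · x)                          ≡⟨ trans (idˡ _) (idˡ _) ⟩
        x                                    ∎)
      y-fix : α y ≡ y
      y-fix = proj₁ (closed-inv closed-b (closed-inv closed-z Fx))
      key : Φ t a · pow z 1 ≡ Φ s a · pow z s
      key = cancelʳ (b · y) (begin
        Φ t a · pow z 1 · (b · y)        ≡⟨ cong (λ w → Φ t a · w · (b · y)) (idʳ z) ⟩
        Φ t a · z · (b · y)              ≡⟨ solve 4 (λ u z b y → (u ⊕ z) ⊕ (b ⊕ y) ⊜ u ⊕ ((z ⊕ b) ⊕ y)) refl (Φ t a) z b y ⟩
        Φ t a · (z · b · y)              ≡⟨ cong (Φ t a ·_) (trans (sym x≡zby) (sym x-fix)) ⟩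
        Φ t a · α x                      ≡⟨ sym eq₁ ⟩
        α (φ a · x)                      ≡⟨ cong α (trans (cong (φ a ·_) x≡zby) (sym (assoc _ _ _))) ⟩
        α (φ a · (z · b) · y)            ≡⟨ cong (λ w → α (w · y)) (sym (trans (φ-· a b) (cong (φ a ·_) φb))) ⟩
        α (φ (a · b) · y)                ≡⟨ eq₂ ⟩
        Φ s (a · b) · α y                ≡⟨ cong₂ _·_ (Φ-ab s) y-fix ⟩
        Φ s a · (pow z s · b) · y        ≡⟨ solve 4 (λ u v b y → (u ⊕ (v ⊕ b)) ⊕ y ⊜ (u ⊕ v) ⊕ (b ⊕ y)) refl (Φ s a) (pow z s) b y ⟩
        Φ s a · pow z s · (b · y)        ∎)
      t≡1 : t % p ≡ 1 % p
      t≡1 with Φ-a-distinct t s 1 s key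
      ... | t≡s , z≡z^s = trans t≡s (sym (pow-injective {z} {1} {s} z^p z≢e z≡z^s))

    closed-c : Closed c
    closed-c {x} Fx = subst (λ w → α w ≡ w) x≡ (acx-fixed (closed-inv closed-a Fx)) ,
                      subst (λ w → α w ≡ w) (assoc a c x) (acx-fixed Fx)
      where
      x≡ : a · c · (inv a · x) ≡ c · x
      x≡ = trans (solve 4 (λ a c a⁻ x → (a ⊕ c) ⊕ (a⁻ ⊕ x) ⊜ (a ⊕ a⁻) ⊕ (c ⊕ x)) refl a c (inv a) x)
        (trans (cong (_· (c · x)) (invʳ a)) (idˡ _))

  ⟨a⟩ ⟨a,b⟩ ⟨a,b,c⟩ B : Subgroup
  ⟨a⟩     = trivial ⟨ a ⟩
  ⟨a,b⟩   = ⟨a⟩ ⟨ b ⟩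
  ⟨a,b,c⟩ = ⟨a,b⟩ ⟨ c ⟩
  B       = ⟨a,b,c⟩ ⟨ z ⟩

  z∈B : z ∈ B
  z∈B = g∈⟨g⟩ ⟨a,b,c⟩ z

  c∈B : c ∈ B
  c∈B = ⟨⟩-⊇ ⟨a,b,c⟩ z (g∈⟨g⟩ ⟨a,b⟩ c)

  b∈B : b ∈ B
  b∈B = ⟨⟩-⊇ ⟨a,b,c⟩ z (⟨⟩-⊇ ⟨a,b⟩ c {b} (g∈⟨g⟩ ⟨a⟩ b))

  a∈B : a ∈ B
  a∈B = ⟨⟩-⊇ ⟨a,b,c⟩ z (⟨⟩-⊇ ⟨a,b⟩ c {a} (⟨⟩-⊇ ⟨a⟩ b {a} (g∈⟨g⟩ trivial a)))

  φ∈⟨⟩ : ∀ {H} g → (∀ {x} → x ∈ H → φ x ∈ H) → φ g ∈ H ⟨ g ⟩ → ∀ {x} → x ∈ H ⟨ g ⟩ → φ x ∈ H ⟨ g ⟩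
  φ∈⟨⟩ {H} g φH φg {x} x∈ with ⟨⟩-elim H g x∈
  ... | h , h∈H , k , refl = subst (_∈ H ⟨ g ⟩) (sym (trans (φ-· h _) (cong (φ h ·_) (φ-pow k))))
      (·∈ (⟨⟩-⊇ H g (φH h∈H)) (pow∈ k φg))
    where
    open Subgroup (H ⟨ g ⟩)
    φ-pow : ∀ k → φ (pow g k) ≡ pow (φ g) k
    φ-pow zero    = φ-fix ψₕ.homo-e ωₕ.homo-e
    φ-pow (suc k) = trans (φ-· g _) (cong (φ g ·_) (φ-pow k))

  φ∈ : ∀ {H} → c ∈ H → z ∈ H → ∀ {x} → x ∈ H → φ x ∈ H
  φ∈ {H} c∈H z∈H {x} x∈H = ·∈ x∈H (·∈ (pow∈ ψ[ x ] c∈H) (pow∈ ω[ x ] z∈H))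
    where open Subgroup H

  S₀⊆B : ∀ {x} → S₀ x → x ∈ B
  S₀⊆B = λ where
      (inj₁ refl)                            → z∈B
      (inj₂ (inj₁ (t , refl)))               → Φ∈B t b∈B
      (inj₂ (inj₂ (inj₁ (t , refl))))        → Φ∈B t a∈B
      (inj₂ (inj₂ (inj₂ (t , refl))))        → Φ∈B t (Subgroup.·∈ B a∈B b∈B)
    where
    Φ∈B : ∀ t {x} → x ∈ B → Φ t x ∈ B
    Φ∈B = Φ-closed {Subgroup.Mem B} (λ {x} → φ∈ {B} c∈B z∈B {x})

  Φ-e : ∀ t → Φ t e ≡ e
  Φ-e t = Φ-fix t (φ-fix ψₕ.homo-e ωₕ.homo-e)

  -- Here `α` acts on all of G. In a layer `S` lies inside `H`, so nothing is said about `α` on the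
  -- other cosets of `H` until `H` is everything.
  Rigid : Subgroup → Pred (Fin n) 0ℓ → Set
  Rigid H S = ∀ {α β} → Automorphism S α β → α e ≡ e → ∃[ t ] ∀ {h} → h ∈ H → α h ≡ Φ t h

  -- The label of the image of the arc from `e` to `a` determines the exponent `s`. After
  -- composition with `Φ⁻¹ s` both `e` and `a` are fixed, and closure under the generators of `B`
  -- does the rest.
  S₀-rigid : Rigid B S₀
  S₀-rigid {α} aut αe with PreservesTypes.a-arc (preservesTypes aut) e (0 , refl)
  ... | _ , (s , refl) , eq = s , λ {h} h∈B → begin
      α h                  ≡⟨ sym (Φ-Φ⁻¹ s (α h)) ⟩
      Φ s (Φ⁻¹ s (α h))    ≡⟨ cong (Φ s) (subst (λ w → Φ⁻¹ s (α w) ≡ w) (idʳ h) (proj₁ (closed-B h∈B e-fixed))) ⟩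
      Φ s h                ∎
    where
    open FixedPoints (preservesTypes-Φ (s * (2 + q)) (preservesTypes aut))
    e-fixed : Fixed e
    e-fixed = trans (cong (Φ⁻¹ s) αe) (Φ-e (s * (2 + q))) , (begin
      Φ⁻¹ s (α (a · e))        ≡⟨ cong (Φ⁻¹ s) (trans eq (trans (cong (Φ s a ·_) αe) (idʳ _))) ⟩
      Φ⁻¹ s (Φ s a)            ≡⟨ Φ⁻¹-Φ s a ⟩
      a                        ≡⟨ sym (idʳ a) ⟩
      a · e                    ∎)
    closed-B : ∀ {h} → h ∈ B → Closed h
    closed-B = closed-⟨⟩ ⟨a,b,c⟩ z (closed-⟨⟩ ⟨a,b⟩ c (closed-⟨⟩ ⟨a⟩ b (closed-⟨⟩ trivial a
      (λ { refl → closed-e }) closed-a) closed-b) closed-c) closed-z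

  Rest : Subgroup → Pred (Fin n) 0ℓ → Pred (Fin n) 0ℓ
  Rest H S x = x ∈ H × x ≢ e × ¬ S x

  -- The inductive invariant. `rest-two` distinguishes arcs inside `H` from those of an adjoined
  -- fixed point; `three` is needed to re-establish `rest-two` one layer up; `φ-S` makes the powers
  -- of φ automorphisms, and `asymmetric` makes the final digraph proper.
  record Layer : Set₁ where
    field
      H          : Subgroup
      S          : Pred (Fin n) 0ℓ
      S?         : Decidable S
      S⊆H        : ∀ {x} → S x → x ∈ H
      e∉S        : ¬ S e
      φ-H        : ∀ {x} → x ∈ H → φ x ∈ H
      φ-S        : ∀ {x} → S x → S (φ x)
      asymmetric : ∃[ s ] (S s × ¬ S (inv s))
      three      : ∃[ s ] ∃[ t ] ∃[ u ] (s ≢ t × s ≢ u × t ≢ u × S s × S t × S u)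
      rest-two   : ∀ {s} → s ∈ H → TwoCommon (Rest H S) s
      rigid      : Rigid H S

  S₀-az : ∀ i → pow z i ≢ e → ¬ S₀ (a · pow z i)
  S₀-az i z^i≢e Saz = case S₀-ψ≡1 Saz (trans (ψₕ.value-0ʳ a (ψₕ.value-pow-0 i ψz)) ψa) of λ where
      (inj₁ o) → a-type o
      (inj₂ o) → case c-type of λ where
        (inj₁ c≡b) → a-type (orbit-ab⇒a c≡b o)
        (inj₂ ωc)  → case trans (sym (ω-ab ωc o)) (trans (ωₕ.value-0ʳ a (ωₕ.value-pow-0 i ωz)) ωa) of λ ()
    where
    a-type : ¬ Orbit a (a · pow z i)
    a-type (t , eq) = z^i≢e (proj₂ (Φ-a-distinct 0 t i 0 (trans eq (sym (idʳ _)))))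

  rest-ψ : ∀ {x} → x ∈ B → ψ[ x ] ≢ 0 → ψ[ x ] ≢ 1 → Rest B S₀ x
  rest-ψ x∈B ψ≢0 ψ≢1 = x∈B , (λ { refl → ψ≢0 ψₕ.homo-e }) , λ Sx → [ ψ≢0 , ψ≢1 ]′ (S₀-ψ Sx)

  -- Labels in `S₀` have ψ-value 0 or 1, and never ψ-value 0 with ω-value 2. So `t` is taken with
  -- ψ-value 2 if ψ(s) = 0, as `a · pow z i` from `S₀-az` if ψ(s) = 1, and with ψ-value 0 and
  -- ω-value 2 otherwise. Multiplication by `z` changes neither value and supplies the second
  -- witness.
  S₀-rest-two : ∀ {s} → s ∈ B → TwoCommon (Rest B S₀) s
  S₀-rest-two {s} s∈B with ψ[ s ] ℕₚ.≟ 0 | ψ[ s ] ℕₚ.≟ 1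
  ... | yes ψs≡0 | _ = aa (a · a) (·∈ a∈B a∈B) (ψ-+ ψa ψa)
    where
    open Subgroup B
    ψ2 : ∀ {x} → x ∈ B → ψ[ x ] ≡ 2 → Rest B S₀ x
    ψ2 x∈B eq = rest-ψ x∈B (λ eq′ → case trans (sym eq) eq′ of λ ()) (λ eq′ → case trans (sym eq) eq′ of λ ())
    aa : ∀ y → y ∈ B → ψ[ y ] ≡ 2 → TwoCommon (Rest B S₀) s
    aa y y∈B ψy = y , y · z , (λ eq → z≢e (cancelˡ y (sym (trans (idʳ y) eq)))) ,
      (ψ2 y∈B ψy , ψ2 (·∈ y∈B s∈B) (trans (ψₕ.value-0ʳ y ψs≡0) ψy)) ,
      (ψ2 (·∈ y∈B z∈B) ψyz , ψ2 (·∈ (·∈ y∈B z∈B) s∈B) (trans (ψₕ.value-0ʳ _ ψs≡0) ψyz))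
      where
      ψyz = trans (ψₕ.value-0ʳ y ψz) ψy
  ... | no _ | yes ψs≡1 = a · pow z 1 , a · pow z 2 ,
      (λ eq → case pow-injective {z} {1} {2} z^p z≢e (cancelˡ a eq) of λ ()) ,
      az 1 (λ eq → z≢e (trans (sym (idʳ z)) eq)) , az 2 z²≢e
    where
    open Subgroup B
    az : ∀ i → pow z i ≢ e → Common (Rest B S₀) s (a · pow z i)
    az i z^i≢e = (az∈B , (λ eq → case trans (sym ψaz) (trans (cong ψ[_] eq) ψₕ.homo-e) of λ ()) , S₀-az i z^i≢e) ,
        rest-ψ (·∈ az∈B s∈B) (λ eq → case trans (sym ψazs) eq of λ ()) (λ eq → case trans (sym ψazs) eq of λ ())
      where
      az∈B = ·∈ a∈B (pow∈ i z∈B)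
      ψaz : ψ[ a · pow z i ] ≡ 1
      ψaz = trans (ψₕ.value-0ʳ a (ψₕ.value-pow-0 i ψz)) ψa
      ψazs : ψ[ a · pow z i · s ] ≡ 2
      ψazs = ψ-+ ψaz ψs≡1
  ... | no ψs≢0 | no ψs≢1 = bb (b · b) (·∈ b∈B b∈B) (ψ-+ ψb ψb) (ω-+ ωb ωb)
    where
    open Subgroup B
    half : ∀ y → y ∈ B → ψ[ y ] ≡ 0 → ω[ y ] ≡ 2 → Common (Rest B S₀) s y
    half y y∈B ψy ωy =
      (y∈B , (λ { refl → case trans (sym ωy) ωₕ.homo-e of λ () }) , λ Sy → S₀-ψω≢02 Sy ψy ωy) ,
      rest-ψ (·∈ y∈B s∈B) (λ eq → ψs≢0 (trans (sym (ψₕ.value-0ˡ s ψy)) eq))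
                          (λ eq → ψs≢1 (trans (sym (ψₕ.value-0ˡ s ψy)) eq))
    bb : ∀ y → y ∈ B → ψ[ y ] ≡ 0 → ω[ y ] ≡ 2 → TwoCommon (Rest B S₀) s
    bb y y∈B ψy ωy = y , y · z , (λ eq → z≢e (cancelˡ y (sym (trans (idʳ y) eq)))) , half y y∈B ψy ωy ,
      half (y · z) (·∈ y∈B z∈B) (trans (ψₕ.value-0ʳ y ψz) ψy) (trans (ωₕ.value-0ʳ y ωz) ωy)

  base : Layer
  base = record
    { H = B ; S = S₀ ; S? = S₀? ; S⊆H = S₀⊆B
    ; e∉S = λ Se → case S₀-ψ≡0 Se ψₕ.homo-e of λ where
        (inj₁ e≡z) → z≢e (sym e≡z)
        (inj₂ o)   → case trans (sym ωₕ.homo-e) (ω-b o) of λ ()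
    ; φ-H = λ {x} → φ∈ {B} c∈B z∈B {x} ; φ-S = φ-S₀
    ; asymmetric = z , inj₁ refl , λ S-z → case S₀-ψ≡0 S-z (ψ-inv ψz) of λ where
        (inj₁ z⁻¹≡z) → z²≢e (trans (cong (z ·_) (trans (idʳ z) (sym z⁻¹≡z))) (invʳ z))
        (inj₂ o)     → case trans (sym (trans (sym (ωₕ.value-0ˡ (inv z) ωz)) (trans (cong ω[_] (invʳ z)) ωₕ.homo-e))) (ω-b o) of λ ()
    ; three = z , b , a , (λ eq → case trans (sym ωz) (trans (cong ω[_] eq) ωb) of λ ()) ,
        (λ eq → case trans (sym ψz) (trans (cong ψ[_] eq) ψa) of λ ()) ,
        (λ eq → case trans (sym ψb) (trans (cong ψ[_] eq) ψa) of λ ()) ,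
        inj₁ refl , inj₂ (inj₁ (0 , refl)) , inj₂ (inj₂ (inj₁ (0 , refl)))
    ; rest-two = S₀-rest-two
    ; rigid = S₀-rigid }
    where
    ψ-inv : ∀ {x} → ψ[ x ] ≡ 0 → ψ[ inv x ] ≡ 0
    ψ-inv {x} ψx = trans (sym (ψₕ.value-0ˡ (inv x) ψx)) (trans (cong ψ[_] (invʳ x)) ψₕ.homo-e)

  -- Adjoining a fixed point of φ to a layer.

  module Extend (L : Layer) {g} (g∉H : ¬ g ∈ Layer.H L) (φg : φ g ≡ g) where
    open Layer L
    open Subgroup H using (mem?; e∈; ·∈; inv∈; cancel∈ˡ; cancel∈ʳ)

    T S′ : Pred (Fin n) 0ℓ
    T = Rest H S
    S′ x = T x ⊎ x ≡ g

    H′ : Subgroup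
    H′ = H ⟨ g ⟩
    module H′ = Subgroup H′

    H⊆H′ : ∀ {x} → x ∈ H → x ∈ H′
    H⊆H′ = ⟨⟩-⊇ H g
    g∈H′ : g ∈ H′
    g∈H′ = g∈⟨g⟩ H g

    T? : Decidable T
    T? x = mem? x ×-dec ¬? (x Finₚ.≟ e) ×-dec ¬? (S? x)

    g≢e : g ≢ e
    g≢e refl = g∉H e∈

    φ-T : ∀ {x} → T x → T (φ x)
    φ-T {x} (x∈H , x≢e , ¬Sx) = φ-H x∈H ,
        (λ eq → x≢e (trans (sym (Φ⁻¹-Φ 1 x)) (trans (cong (Φ⁻¹ 1) eq) (Φ-e (1 * (2 + q)))))) ,
        (λ Sφx → ¬Sx (subst S (Φ⁻¹-Φ 1 x) (Φ-closed {S} φ-S (1 * (2 + q)) Sφx)))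

    gT-rest : ∀ {t} → T t → Rest H′ S′ (g · t)
    gT-rest {t} (t∈H , t≢e , _) = H′.·∈ g∈H′ (H⊆H′ t∈H) ,
      (λ eq → g∉H (cancel∈ʳ t∈H (subst (_∈ H) (sym eq) e∈))) ,
      λ where
        (inj₁ (gt∈H , _)) → g∉H (cancel∈ʳ t∈H gt∈H)
        (inj₂ gt≡g)       → t≢e (cancelˡ g (trans gt≡g (sym (idʳ g))))

    S-rest : ∀ {t} → S t → Rest H′ S′ t
    S-rest St = H⊆H′ (S⊆H St) , (λ { refl → e∉S St }) , λ where
      (inj₁ (_ , _ , ¬St)) → ¬St St
      (inj₂ refl)          → g∉H (S⊆H St)

    Ss-rest : ∀ {s t} → s ∈ H′ → s ∉ H → S t → t · s ≢ g → Common (Rest H′ S′) s t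
    Ss-rest s∈H′ s∉H St ts≢g = S-rest St ,
      H′.·∈ (H⊆H′ (S⊆H St)) s∈H′ ,
      (λ eq → s∉H (cancel∈ˡ (S⊆H St) (subst (_∈ H) (sym eq) e∈))) ,
      λ where
        (inj₁ (ts∈H , _)) → s∉H (cancel∈ˡ (S⊆H St) ts∈H)
        (inj₂ ts≡g)       → ts≢g ts≡g

    -- For `s ∈ H` the old witnesses are translated by `g`, since the coset of `g` meets `S′` only
    -- in `g`. For `s ∉ H` the elements `t` of `S` serve, as they have left the connection set:
    -- `t · s` is outside `H`, hence in `S′` only if it equals `g`, which rules out at most one of
    -- three.
    rest-two′ : ∀ {s} → s ∈ H′ → TwoCommon (Rest H′ S′) s
    rest-two′ {s} s∈H′ with mem? s
    ... | yes s∈H with t , t′ , t≢t′ , (Tt , Tts) , (Tt′ , Tts′) ← rest-two s∈H =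
      g · t , g · t′ , (λ eq → t≢t′ (cancelˡ g eq)) ,
      (gT-rest Tt  , subst (Rest H′ S′) (sym (assoc g t s)) (gT-rest Tts)) ,
      (gT-rest Tt′ , subst (Rest H′ S′) (sym (assoc g t′ s)) (gT-rest Tts′))
    ... | no s∉H with three
    ... | t , t′ , t″ , t≢t′ , t≢t″ , t′≢t″ , St , St′ , St″ with t · s Finₚ.≟ g | t′ · s Finₚ.≟ g
    ... | no ts≢g  | no t′s≢g = t , t′ , t≢t′ , Ss-rest s∈H′ s∉H St ts≢g , Ss-rest s∈H′ s∉H St′ t′s≢g
    ... | yes ts≡g | _ = t′ , t″ , t′≢t″ ,
      Ss-rest s∈H′ s∉H St′ (λ eq → t≢t′ (cancelʳ s (trans ts≡g (sym eq)))) ,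
      Ss-rest s∈H′ s∉H St″ (λ eq → t≢t″ (cancelʳ s (trans ts≡g (sym eq))))
    ... | no ts≢g  | yes t′s≡g = t , t″ , t≢t″ , Ss-rest s∈H′ s∉H St ts≢g ,
      Ss-rest s∈H′ s∉H St″ (λ eq → t′≢t″ (cancelʳ s (trans t′s≡g (sym eq))))

    twoCommon-T : ∀ {s} → s ∈ H → TwoCommon S′ s
    twoCommon-T s∈H with t , t′ , t≢t′ , (Tt , Tts) , (Tt′ , Tts′) ← rest-two s∈H =
      t , t′ , t≢t′ , (inj₁ Tt , inj₁ Tts) , (inj₁ Tt′ , inj₁ Tts′)

    common-g : ∀ {t} → Common S′ g t → t ≡ g
    common-g (inj₂ t≡g , _) = t≡g
    common-g (inj₁ (t∈H , _) , inj₁ (tg∈H , _)) = ⊥-elim (g∉H (cancel∈ˡ t∈H tg∈H))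
    common-g (inj₁ (_ , t≢e , _) , inj₂ tg≡g) = ⊥-elim (t≢e (cancelʳ g (trans tg≡g (sym (idˡ g)))))

    ¬twoCommon-g : ¬ TwoCommon S′ g
    ¬twoCommon-g (t , t′ , t≢t′ , C , C′) = t≢t′ (trans (common-g C) (sym (common-g C′)))

    T-preserved : ∀ {α β} → Automorphism S′ α β → ∀ {s} u → T s → ∃[ t ] (T t × α (s · u) ≡ t · α u)
    T-preserved aut u Ts@(s∈H , _) with Automorphism.forward aut u (inj₁ Ts)
    ... | t , inj₁ Tt , eq = t , Tt , eq
    ... | t , inj₂ refl , eq = ⊥-elim (¬twoCommon-g (twoCommon-image aut u eq (twoCommon-T s∈H)))

    g-preserved : ∀ {α β} → Automorphism S′ α β → ∀ u → α (g · u) ≡ g · α u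
    g-preserved aut u with Automorphism.forward aut u (inj₂ refl)
    ... | t , inj₂ refl , eq = eq
    ... | t , inj₁ (t∈H , _) , eq = ⊥-elim (¬twoCommon-g (twoCommon-preimage aut u eq (twoCommon-T t∈H)))

    -- By `rest-two`, `s` is the quotient of `t · s` by `t`, both in `T`. Since arcs of `T` are
    -- preserved, the image label is a quotient of two elements of `T` as well.
    H-preserved : ∀ {α β} → Automorphism S′ α β → ∀ {s} u → s ∈ H → ∃[ t ] (t ∈ H × α (s · u) ≡ t · α u)
    H-preserved {α} aut {s} u s∈H
      with t , _ , _ , (Tt , Tts) , _ ← rest-two s∈H
      with T-preserved aut (s · u) Tt | T-preserved aut u Tts
    ... | t₁ , (t₁∈H , _) , eq₁ | t₂ , (t₂∈H , _) , eq₂ =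
      y , cancel∈ˡ t₁∈H (subst (_∈ H) (cancelʳ (α u) (begin
        t₂ · α u           ≡⟨ sym eq₂ ⟩
        α (t · s · u)      ≡⟨ cong α (assoc t s u) ⟩
        α (t · (s · u))    ≡⟨ eq₁ ⟩
        t₁ · α (s · u)     ≡⟨ cong (t₁ ·_) eq ⟩
        t₁ · (y · α u)     ≡⟨ sym (assoc _ _ _) ⟩
        t₁ · y · α u       ∎)) t₂∈H) , eq
      where
      y = α (s · u) · inv (α u)
      eq : α (s · u) ≡ y · α u
      eq = sym (·-inv-· (α u) (α (s · u)))

    -- Inside `H` the set `S` is what remains after removing `e` and `T`. Labels in `H` stay in `H`,
    -- label `e` is excluded by injectivity, and a label in `T` is pulled back to `T` by the
    -- inverse.
    S-preserved : ∀ {α β} → Automorphism S′ α β → ∀ {s} u → S s → ∃[ t ] (S t × α (s · u) ≡ t · α u)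
    S-preserved {α} {β} aut {s} u Ss with H-preserved aut u (S⊆H Ss)
    ... | y , y∈H , eq with S? y
    ... | yes Sy = y , Sy , eq
    ... | no ¬Sy with y Finₚ.≟ e
    ... | yes refl = ⊥-elim (e∉S (subst S (cancelʳ u (injective (begin
      α (s · u)    ≡⟨ eq ⟩
      e · α u      ≡⟨ idˡ _ ⟩
      α u          ≡⟨ cong α (sym (idˡ u)) ⟩
      α (e · u)    ∎))) Ss))
      where open Automorphism aut
    ... | no y≢e with T-preserved (reverse aut) (α u) (y∈H , y≢e , ¬Sy)
    ... | t , (_ , _ , ¬St) , eq′ = ⊥-elim (¬St (subst S (cancelʳ u (begin
      s · u            ≡⟨ sym (β∘α _) ⟩
      β (α (s · u))    ≡⟨ cong β eq ⟩
      β (y · α u)      ≡⟨ eq′ ⟩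
      t · β (α u)      ≡⟨ cong (t ·_) (β∘α u) ⟩
      t · u            ∎)) Ss))
      where open Automorphism aut

    restrict : ∀ {α β} → Automorphism S′ α β → Automorphism S α β
    restrict aut = record { β∘α = β∘α ; α∘β = α∘β
      ; forward = S-preserved aut ; backward = S-preserved (reverse aut) }
      where open Automorphism aut

    -- On `H` the old rigidity applies after `restrict`. Arcs of `g` are preserved exactly and φ
    -- fixes `g`, so the same exponent serves on every coset of `H`.
    rigid′ : Rigid H′ S′
    rigid′ {α} aut αe with rigid (restrict aut) αe
    ... | t , α≡Φ = t , λ x∈H′ → case ⟨⟩-elim H g x∈H′ of λ where
        (h , h∈H , k , refl) → begin
          α (h · pow g k)      ≡⟨ cong α (comm h _) ⟩
          α (pow g k · h)      ≡⟨ α-pow k h ⟩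
          pow g k · α h        ≡⟨ cong (pow g k ·_) (α≡Φ h∈H) ⟩
          pow g k · Φ t h      ≡⟨ comm _ _ ⟩
          Φ t h · pow g k      ≡⟨ cong (Φ t h ·_) (sym (Φ-fix t (φ-pow k))) ⟩
          Φ t h · Φ t (pow g k) ≡⟨ sym (Φ-· t h _) ⟩
          Φ t (h · pow g k)    ∎
      where
      α-pow : ∀ k u → α (pow g k · u) ≡ pow g k · α u
      α-pow zero    u = trans (cong α (idˡ u)) (sym (idˡ _))
      α-pow (suc k) u = begin
        α (g · pow g k · u)      ≡⟨ cong α (assoc _ _ _) ⟩
        α (g · (pow g k · u))    ≡⟨ g-preserved aut _ ⟩
        g · α (pow g k · u)      ≡⟨ cong (g ·_) (α-pow k u) ⟩
        g · (pow g k · α u)      ≡⟨ sym (assoc _ _ _) ⟩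
        g · pow g k · α u        ∎
      φ-pow : ∀ k → φ (pow g k) ≡ pow g k
      φ-pow zero    = φ-fix ψₕ.homo-e ωₕ.homo-e
      φ-pow (suc k) = trans (φ-· g _) (cong₂ _·_ φg (φ-pow k))

    extend : Layer
    extend = record
      { H = H′ ; S = S′
      ; S? = λ x → T? x ⊎-dec (x Finₚ.≟ g)
      ; S⊆H = λ { (inj₁ (x∈H , _)) → H⊆H′ x∈H ; (inj₂ refl) → g∈H′ }
      ; e∉S = λ { (inj₁ (_ , e≢e , _)) → e≢e refl ; (inj₂ e≡g) → g≢e (sym e≡g) }
      ; φ-H = λ {x} → φ∈⟨⟩ {H} g φ-H (subst (_∈ H′) (sym φg) g∈H′) {x}
      ; φ-S = λ { (inj₁ Tx) → inj₁ (φ-T Tx) ; (inj₂ refl) → inj₂ φg }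
      -- Complementation swaps the roles: the inverse was missing from `S` and now belongs to `T`,
      -- while `s` no longer belongs to the connection set.
      ; asymmetric = case asymmetric of λ (s , Ss , ¬S-s) → inv s ,
          inj₁ (inv∈ (S⊆H Ss) ,
            (λ eq → e∉S (subst S (trans (sym (idʳ s)) (trans (cong (s ·_) (sym eq)) (invʳ s))) Ss)) , ¬S-s) ,
          λ S′s → proj₂ (proj₂ (S-rest Ss)) (subst S′ (inv-involutive s) S′s)
      -- At `e` the two conditions of `Common` coincide, so `rest-two` yields two distinct elements
      -- of `T`; `g` is the third.
      ; three = case rest-two e∈ of λ (t , t′ , t≢t′ , (Tt , _) , (Tt′ , _)) →
          t , t′ , g , t≢t′ , (λ { refl → g∉H (proj₁ Tt) }) , (λ { refl → g∉H (proj₁ Tt′) }) ,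
          inj₁ Tt , inj₁ Tt′ , inj₂ refl
      ; rest-two = rest-two′
      ; rigid = rigid′ }

  open Layer using (H)

  all-fixed : ∃[ L ] ((∀ {x} → x ∈ B → x ∈ H L) × (∀ g → φ g ≡ g → g ∈ H L))
  all-fixed = saturate {State = Layer} {_⊑_ = λ L M → ∀ {x} → x ∈ H L → x ∈ H M}
      {Good = λ g L → φ g ≡ g → g ∈ H L}
      (λ x∈ → x∈) (λ s t x∈ → t (s x∈)) (λ s good eq → s (good eq)) step base
    where
    step : ∀ g L → ∃[ M ] ((∀ {x} → x ∈ H L → x ∈ H M) × (φ g ≡ g → g ∈ H M))
    step g L with φ g Finₚ.≟ g | Subgroup.mem? (H L) g
    ... | no φg≢g | _       = L , (λ x∈ → x∈) , λ eq → ⊥-elim (φg≢g eq)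
    ... | yes _   | yes g∈H = L , (λ x∈ → x∈) , λ _ → g∈H
    ... | yes φg  | no g∉H  = Extend.extend L g∉H φg , ⟨⟩-⊇ (H L) g , λ _ → g∈⟨g⟩ (H L) g

  -- Dividing `x` by b^ω(x) and a^ψ(x) gives an element killed by ψ and ω, hence fixed by φ. The
  -- exponents `i x` and `j x` are the negatives of ω(x) and ψ(x) modulo p.
  full-layer : ∃[ L ] ∀ x → x ∈ H L
  full-layer with all-fixed
  ... | L , B⊆H , fixed⊆H = L , λ x →
      cancel∈ʳ (B⊆H (Subgroup.pow∈ B (i x) b∈B)) (cancel∈ʳ (B⊆H (Subgroup.pow∈ B (j x) a∈B)) (fixed⊆H _ (φ-fix (ψ-k x) (ω-k x))))
    where
    open Subgroup (H L) using (cancel∈ʳ)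
    cancels : ∀ k → (k + (k * (2 + q) * 1) % p) % p ≡ 0
    cancels k = begin
      (k + (k * (2 + q) * 1) % p) % p              ≡⟨ cong (λ l → (k + l % p) % p) (ℕₚ.*-identityʳ (k * (2 + q))) ⟩
      (k + (k * (2 + q)) % p) % p                  ≡⟨ %-distribˡ-+ k _ p ⟩
      (k % p + (k * (2 + q)) % p % p) % p          ≡⟨ cong (λ l → (k % p + l) % p) (m%n%n≡m%n (k * (2 + q)) p) ⟩
      (k % p + (k * (2 + q)) % p) % p              ≡⟨ sym (%-distribˡ-+ k (k * (2 + q)) p) ⟩
      (k + k * (2 + q)) % p                        ≡⟨ cong (_% p) (sym (*-suc k (2 + q))) ⟩
      (k * p) % p                                  ≡⟨ m*n%n≡0 k p ⟩
      0                                            ∎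
    i j : Fin n → ℕ
    i x = ω[ x ] * (2 + q)
    j x = ψ[ x ] * (2 + q)
    ψ-k : ∀ x → ψ[ x · pow b (i x) · pow a (j x) ] ≡ 0
    ψ-k x = begin
      ψ[ x · pow b (i x) · pow a (j x) ]                   ≡⟨ ψₕ.homo _ _ ⟩
      (ψ[ x · pow b (i x) ] + ψ[ pow a (j x) ]) % p        ≡⟨ cong₂ (λ k l → (k + l) % p)
                                                                (ψₕ.value-0ʳ x (ψₕ.value-pow-0 (i x) ψb))
                                                                (trans (ψₕ.value-pow a (j x)) (cong (λ k → (j x * k) % p) ψa)) ⟩
      (ψ[ x ] + (j x * 1) % p) % p                         ≡⟨ cancels ψ[ x ] ⟩
      0                                                    ∎
    ω-k : ∀ x → ω[ x · pow b (i x) · pow a (j x) ] ≡ 0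
    ω-k x = begin
      ω[ x · pow b (i x) · pow a (j x) ]                   ≡⟨ ωₕ.value-0ʳ _ (ωₕ.value-pow-0 (j x) ωa) ⟩
      ω[ x · pow b (i x) ]                                 ≡⟨ ωₕ.homo x _ ⟩
      (ω[ x ] + ω[ pow b (i x) ]) % p                      ≡⟨ cong (λ l → (ω[ x ] + l) % p)
                                                                (trans (ωₕ.value-pow b (i x)) (cong (λ k → (i x * k) % p) ωb)) ⟩
      (ω[ x ] + (i x * 1) % p) % p                         ≡⟨ cancels ω[ x ] ⟩
      0                                                    ∎

-- The resulting Cayley digraph: its automorphism group and a regular subgroup.

module _ {m} {Q : Pred (Fin m) 0ℓ} (Q? : Decidable Q) where
  subset : Subset m
  subset = tabulate (does ∘ Q?)

  ∈-subset⁺ : ∀ {x} → Q x → x ∈ₛ subset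
  ∈-subset⁺ {x} Qx = lookup⇒[]= x subset (trans (lookup∘tabulate _ x) (dec-true (Q? x) Qx))

  ∈-subset⁻ : ∀ {x} → x ∈ₛ subset → Q x
  ∈-subset⁻ {x} x∈ with Q? x | trans (sym (lookup∘tabulate (does ∘ Q?) x)) ([]=⇒lookup x∈)
  ... | yes Qx | _ = Qx

module CayleyIndex-p (G : FiniteAbelianGroup) (q : ℕ) (prime : Prime (3 + q))
  (twist : PrimeExponent.Twist G q prime) where
  open Tower G q prime twist

  layer : Layer
  layer = proj₁ full-layer

  open Layer layer

  S̄ : Subset n
  S̄ = subset S?

  Φ-S : ∀ t {x} → S x → S (Φ t x)
  Φ-S = Φ-closed {S} φ-S

  Φ-S⁻ : ∀ t {x} → S (Φ t x) → S x
  Φ-S⁻ t {x} Sx = subst S (Φ⁻¹-Φ t x) (Φ-S (t * (2 + q)) Sx)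

  quotient : ∀ {s u v} → v ≡ s · u → v · inv u ≡ s
  quotient {s} {u} refl = trans (assoc _ _ _) (trans (cong (s ·_) (invʳ u)) (idʳ s))

  quotient⁻ : ∀ u v → v ≡ (v · inv u) · u
  quotient⁻ u v = sym (·-inv-· u v)

  Arc⁺ : ∀ {s u v} → S s → v ≡ s · u → Arc S̄ u v
  Arc⁺ Ss eq = ∈-subset⁺ S? (subst S (sym (quotient eq)) Ss)

  affine-isAut : ∀ σ t g → (∀ x → σ ⟨$⟩ʳ x ≡ Φ t x · g) → IsAut S̄ σ
  affine-isAut σ t g σ≡ u v = mk⇔
      (λ uv → Arc⁺ (Φ-S t (∈-subset⁻ S? uv)) σv≡)
      (λ uv → ∈-subset⁺ S? (Φ-S⁻ t (subst S (quotient σv≡) (∈-subset⁻ S? uv))))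
    where
    s = v · inv u
    σv≡ : σ ⟨$⟩ʳ v ≡ Φ t s · (σ ⟨$⟩ʳ u)
    σv≡ = begin
      σ ⟨$⟩ʳ v                 ≡⟨ σ≡ v ⟩
      Φ t v · g                ≡⟨ cong (λ w → Φ t w · g) (quotient⁻ u v) ⟩
      Φ t (s · u) · g          ≡⟨ cong (_· g) (Φ-· t s u) ⟩
      Φ t s · Φ t u · g        ≡⟨ assoc _ _ _ ⟩
      Φ t s · (Φ t u · g)      ≡⟨ cong (Φ t s ·_) (sym (σ≡ u)) ⟩
      Φ t s · (σ ⟨$⟩ʳ u)       ∎

  affine : ℕ → Fin n → Permutation′ n
  affine t g = permutation (λ x → Φ t x · g) (λ y → Φ⁻¹ t (y · inv g))
    (λ y → trans (cong (_· g) (Φ-Φ⁻¹ t _)) (·-inv-· g y))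
    (λ x → trans (cong (Φ⁻¹ t) (quotient refl)) (Φ⁻¹-Φ t x))

  -- Dividing by the image of `e` gives an automorphism that fixes `e`, to which `rigid` applies; as
  -- `H` is all of G, the exponent is valid at every vertex.
  aut-affine : ∀ σ → IsAut S̄ σ → ∃[ t ] ∀ x → σ ⟨$⟩ʳ x ≡ Φ t x · (σ ⟨$⟩ʳ e)
  aut-affine σ σ-aut with rigid automorphism (invʳ (σ ⟨$⟩ʳ e))
    where
    g = σ ⟨$⟩ʳ e
    automorphism : Automorphism S (λ x → (σ ⟨$⟩ʳ x) · inv g) (λ y → σ ⟨$⟩ˡ (y · g))
    automorphism = record
      { β∘α = λ x → trans (cong (σ ⟨$⟩ˡ_) (·-inv-· g _)) (Perm.inverseˡ σ)
      ; α∘β = λ y → trans (cong (_· inv g) (Perm.inverseʳ σ)) (quotient refl)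
      ; forward = λ {s} u Ss →
          _ , ∈-subset⁻ S? (Equivalence.to (σ-aut u (s · u)) (Arc⁺ Ss refl)) ,
          trans (cong (_· inv g) (quotient⁻ (σ ⟨$⟩ʳ u) _)) (assoc _ _ _)
      ; backward = λ {s} u Ss →
          _ , ∈-subset⁻ S? (Equivalence.from (σ-aut _ _) (Arc⁺ Ss
            (trans (Perm.inverseʳ σ) (trans (assoc s u g) (cong (s ·_) (sym (Perm.inverseʳ σ))))))) ,
          quotient⁻ (σ ⟨$⟩ˡ (u · g)) _ }
  ... | t , α≡Φ = t , λ x → trans (quotient⁻′ x) (cong (_· (σ ⟨$⟩ʳ e)) (α≡Φ (proj₂ full-layer x)))
    where
    quotient⁻′ : ∀ x → σ ⟨$⟩ʳ x ≡ ((σ ⟨$⟩ʳ x) · inv (σ ⟨$⟩ʳ e)) · (σ ⟨$⟩ʳ e)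
    quotient⁻′ x = quotient⁻ (σ ⟨$⟩ʳ e) (σ ⟨$⟩ʳ x)

  Φ-e-· : ∀ t g → Φ t e · g ≡ g
  Φ-e-· t g = trans (cong (_· g) (Φ-e t)) (idˡ g)

  affine-injective : ∀ {s t g h} → (∀ x → Φ s x · g ≡ Φ t x · h) → s % p ≡ t % p × g ≡ h
  affine-injective {s} {t} {g} {h} eq = s≡t , g≡h
    where
    g≡h : g ≡ h
    g≡h = trans (sym (Φ-e-· s g)) (trans (eq e) (Φ-e-· t h))
    s≡t : s % p ≡ t % p
    s≡t = proj₁ (Φ-a-distinct s t 0 0 (cong (_· e)
      (cancelʳ g (trans (eq a) (cong (Φ t a ·_) (sym g≡h))))))

  cayleyIndex : CayleyIndex S̄ p
  cayleyIndex = f , f-injective , f-surjective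
    where
    f : Fin (p * n) → Aut S̄
    f i = let t , g = remQuot {p} n i in affine (toℕ t) g , affine-isAut (affine (toℕ t) g) (toℕ t) g (λ _ → refl)
    f-injective : ∀ i j → proj₁ (f i) Perm.≈ proj₁ (f j) → i ≡ j
    f-injective i j eq = begin
        i                                                ≡⟨ sym (Finₚ.combine-remQuot {p} n i) ⟩
        combine (proj₁ (remQuot n i)) (proj₂ (remQuot n i)) ≡⟨ cong₂ combine (Finₚ.toℕ-injective ti≡tj) (proj₂ tg) ⟩
        combine (proj₁ (remQuot n j)) (proj₂ (remQuot n j)) ≡⟨ Finₚ.combine-remQuot {p} n j ⟩
        j                                                ∎
      where
      ti tj : Fin p
      ti = proj₁ (remQuot {p} n i)
      tj = proj₁ (remQuot {p} n j)
      tg : toℕ ti % p ≡ toℕ tj % p × proj₂ (remQuot {p} n i) ≡ proj₂ (remQuot {p} n j)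
      tg = affine-injective {toℕ ti} {toℕ tj} eq
      ti≡tj : toℕ ti ≡ toℕ tj
      ti≡tj = trans (sym (m<n⇒m%n≡m (Finₚ.toℕ<n ti))) (trans (proj₁ tg) (m<n⇒m%n≡m (Finₚ.toℕ<n tj)))
    f-surjective : ∀ (σ : Aut S̄) → ∃[ i ] proj₁ (f i) Perm.≈ proj₁ σ
    f-surjective (σ , σ-aut) with aut-affine σ σ-aut
    ... | t , σ≡ = combine t′ g , λ x → begin
        affine (toℕ (proj₁ (remQuot n (combine t′ g)))) (proj₂ (remQuot {p} n (combine t′ g))) ⟨$⟩ʳ x
          ≡⟨ cong (λ (t , g) → affine (toℕ t) g ⟨$⟩ʳ x) (Finₚ.remQuot-combine t′ g) ⟩
        Φ (toℕ t′) x · g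
          ≡⟨ cong (λ t → Φ t x · g) (Finₚ.toℕ-fromℕ< (m%n<n t p)) ⟩
        Φ (t % p) x · g
          ≡⟨ cong (_· g) (sym (Φ-%-≡ t x)) ⟩
        Φ t x · g
          ≡⟨ sym (σ≡ x) ⟩
        σ ⟨$⟩ʳ x ∎
      where
      t′ : Fin p
      t′ = fromℕ< (m%n<n t p)
      g = σ ⟨$⟩ʳ e

  Φ-inv : ∀ t x → Φ t (inv x) ≡ inv (Φ t x)
  Φ-inv t x = inv-unique _ _ (trans (sym (Φ-· t x (inv x))) (trans (cong (Φ t) (invʳ x)) (Φ-e t)))

  -- Among the maps `Φ t x · r` these are the ones whose exponent is dictated by the translation
  -- part. They are closed under composition because ψ is a homomorphism invariant under φ.
  R : Pred (Permutation′ n) 0ℓ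
  R σ = ∃[ r ] ∀ x → σ ⟨$⟩ʳ x ≡ Φ ψ[ r ] x · r

  R-isAutSubgroup : IsAutSubgroup S̄ R
  R-isAutSubgroup = record
    { aut  = λ {σ} (r , σ≡) → affine-isAut σ ψ[ r ] r σ≡
    ; id∈  = e , λ x → trans (sym (idʳ x)) (cong (λ t → Φ t x · e) (sym ψₕ.homo-e))
    ; ∘∈   = λ {σ} {τ} (r , σ≡) (s , τ≡) → Φ ψ[ s ] r · s , λ x → begin
        τ ⟨$⟩ʳ (σ ⟨$⟩ʳ x)                            ≡⟨ τ≡ _ ⟩
        Φ ψ[ s ] (σ ⟨$⟩ʳ x) · s                      ≡⟨ cong (λ w → Φ ψ[ s ] w · s) (σ≡ x) ⟩
        Φ ψ[ s ] (Φ ψ[ r ] x · r) · s                ≡⟨ cong (_· s) (Φ-· ψ[ s ] _ r) ⟩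
        Φ ψ[ s ] (Φ ψ[ r ] x) · Φ ψ[ s ] r · s       ≡⟨ assoc _ _ _ ⟩
        Φ ψ[ s ] (Φ ψ[ r ] x) · (Φ ψ[ s ] r · s)     ≡⟨ cong (_· (Φ ψ[ s ] r · s)) (sym (Φ-+ ψ[ s ] ψ[ r ] x)) ⟩
        Φ (ψ[ s ] + ψ[ r ]) x · (Φ ψ[ s ] r · s)     ≡⟨ cong (_· (Φ ψ[ s ] r · s)) (Φ-%-≡ (ψ[ s ] + ψ[ r ]) x) ⟩
        Φ ((ψ[ s ] + ψ[ r ]) % p) x · (Φ ψ[ s ] r · s) ≡⟨ cong (λ t → Φ t x · (Φ ψ[ s ] r · s)) (sym (ψ-∘ r s)) ⟩
        Φ ψ[ Φ ψ[ s ] r · s ] x · (Φ ψ[ s ] r · s)   ∎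
    ; inv∈ = λ {σ} (r , σ≡) → let r′ = Φ⁻¹ ψ[ r ] (inv r) in r′ , λ x → begin
        σ ⟨$⟩ˡ x                           ≡⟨ cong (σ ⟨$⟩ˡ_) (sym (trans (σ≡ _) (cancels r x))) ⟩
        σ ⟨$⟩ˡ (σ ⟨$⟩ʳ (Φ ψ[ r′ ] x · r′))  ≡⟨ Perm.inverseˡ σ ⟩
        Φ ψ[ r′ ] x · r′                   ∎
    }
    where
    ψ-∘ : ∀ r s → ψ[ Φ ψ[ s ] r · s ] ≡ (ψ[ s ] + ψ[ r ]) % p
    ψ-∘ r s = trans (ψₕ.homo _ s)
      (cong (_% p) (trans (cong (_+ ψ[ s ]) (ψ-Φ ψ[ s ] r)) (+-comm ψ[ r ] ψ[ s ])))
    cancels : ∀ r x → let r′ = Φ⁻¹ ψ[ r ] (inv r) in Φ ψ[ r ] (Φ ψ[ r′ ] x · r′) · r ≡ x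
    cancels r x = begin
      Φ ψ[ r ] (Φ ψ[ r′ ] x · r′) · r            ≡⟨ cong (_· r) (Φ-· ψ[ r ] _ r′) ⟩
      Φ ψ[ r ] (Φ ψ[ r′ ] x) · Φ ψ[ r ] r′ · r   ≡⟨ cong₂ (λ u v → u · v · r) (sym (Φ-+ ψ[ r ] ψ[ r′ ] x)) (Φ-Φ⁻¹ ψ[ r ] (inv r)) ⟩
      Φ (ψ[ r ] + ψ[ r′ ]) x · inv r · r         ≡⟨ ·-inv-· r _ ⟩
      Φ (ψ[ r ] + ψ[ r′ ]) x                     ≡⟨ Φ-≡% (ψ[ r ] + ψ[ r′ ]) 0 (begin
          (ψ[ r ] + ψ[ r′ ]) % p      ≡⟨ cong (λ k → (ψ[ r ] + k) % p) (ψ-Φ (ψ[ r ] * (2 + q)) (inv r)) ⟩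
          (ψ[ r ] + ψ[ inv r ]) % p   ≡⟨ sym (ψₕ.homo r (inv r)) ⟩
          ψ[ r · inv r ]              ≡⟨ trans (cong ψ[_] (invʳ r)) ψₕ.homo-e ⟩
          0 ∎) x ⟩
      x                                          ∎
      where r′ = Φ⁻¹ ψ[ r ] (inv r)

  -- Applying ψ to `Φ ψ[ r ] u · r ≡ v` gives ψ(r) = ψ(u⁻¹v). The exponent is thus known before `r`,
  -- and the equation can be solved for `r` in one way.
  R-isRegular : IsRegular R
  R-isRegular u v = (affine ψ[ r₀ ] r₀ , (r₀ , λ _ → refl) , (begin
      Φ ψ[ r₀ ] u · r₀                   ≡⟨ cong (λ t → Φ t u · r₀) ψ-r₀ ⟩
      Φ k u · (Φ k (inv u) · v)          ≡⟨ sym (assoc _ _ _) ⟩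
      Φ k u · Φ k (inv u) · v            ≡⟨ cong (_· v) (trans (sym (Φ-· k u (inv u))) (trans (cong (Φ k) (invʳ u)) (Φ-e k))) ⟩
      e · v                              ≡⟨ idˡ v ⟩
      v                                  ∎)) ,
    λ σ τ (r , σ≡) (s , τ≡) σu τu x → begin
      σ ⟨$⟩ʳ x           ≡⟨ σ≡ x ⟩
      Φ ψ[ r ] x · r     ≡⟨ cong (λ r → Φ ψ[ r ] x · r) (trans (unique r (trans (sym (σ≡ u)) σu)) (sym (unique s (trans (sym (τ≡ u)) τu)))) ⟩
      Φ ψ[ s ] x · s     ≡⟨ sym (τ≡ x) ⟩
      τ ⟨$⟩ʳ x           ∎
    where
    k = ψ[ inv u · v ]
    r₀ = Φ k (inv u) · v
    ψ-shift : ∀ t → ψ[ Φ t (inv u) · v ] ≡ k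
    ψ-shift t = trans (ψₕ.homo _ v)
      (trans (cong (λ i → (i + ψ[ v ]) % p) (ψ-Φ t (inv u))) (sym (ψₕ.homo (inv u) v)))
    ψ-r₀ : ψ[ r₀ ] ≡ k
    ψ-r₀ = ψ-shift k
    unique : ∀ r → Φ ψ[ r ] u · r ≡ v → r ≡ r₀
    unique r eq = trans r≡ (cong (λ t → Φ t (inv u) · v) (trans (cong ψ[_] r≡) (ψ-shift ψ[ r ])))
      where
      r≡ : r ≡ Φ ψ[ r ] (inv u) · v
      r≡ = cancelˡ (Φ ψ[ r ] u) (begin
        Φ ψ[ r ] u · r                            ≡⟨ eq ⟩
        v                                         ≡⟨ sym (idˡ v) ⟩
        e · v                                     ≡⟨ cong (_· v) (sym (trans (cong (Φ ψ[ r ] u ·_) (Φ-inv ψ[ r ] u)) (invʳ _))) ⟩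
        Φ ψ[ r ] u · Φ ψ[ r ] (inv u) · v         ≡⟨ assoc _ _ _ ⟩
        Φ ψ[ r ] u · (Φ ψ[ r ] (inv u) · v)       ∎)

  R-isNonabelian : IsNonabelian R
  R-isNonabelian = affine ψ[ a ] a , affine ψ[ b ] b , (a , λ _ → refl) , (b , λ _ → refl) ,
    λ commute → z≢e (cancelʳ (b · a) (begin
      z · (b · a)                               ≡⟨ sym (assoc _ _ _) ⟩
      z · b · a                                 ≡⟨ cong (_· a) (sym φb) ⟩
      φ b · a                                   ≡⟨ cong (λ t → Φ t b · a) (sym ψa) ⟩
      Φ ψ[ a ] b · a                            ≡⟨ cong (λ w → Φ ψ[ a ] w · a) (sym (Φ-e-· ψ[ b ] b)) ⟩
      Φ ψ[ a ] (Φ ψ[ b ] e · b) · a             ≡⟨ sym (commute e) ⟩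
      Φ ψ[ b ] (Φ ψ[ a ] e · a) · b             ≡⟨ cong (λ t → Φ t (Φ ψ[ a ] e · a) · b) ψb ⟩
      Φ ψ[ a ] e · a · b                        ≡⟨ cong (_· b) (Φ-e-· ψ[ a ] a) ⟩
      a · b                                     ≡⟨ comm a b ⟩
      b · a                                     ≡⟨ sym (idˡ _) ⟩
      e · (b · a)                               ∎))

  conclusion : ∃[ S ] (e ∉ₛ S × IsProper S × CayleyIndex S p × HasNonabelianRegularSubgroup S)
  conclusion = S̄ , (λ e∈ → e∉S (∈-subset⁻ S? e∈)) ,
    (case asymmetric of λ (s , Ss , ¬S-s) → e , s , Arc⁺ Ss (sym (idʳ s)) ,
       λ arc → ¬S-s (subst S (idˡ _) (∈-subset⁻ S? arc))) ,
    cayleyIndex , R , R-isAutSubgroup , R-isRegular , R-isNonabelian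

-- Counting in subsets and splitting off the p-part.

enumerate : ∀ {m} (K : Subset m) → Σ (Fin ∣ K ∣ → Fin m) λ f →
  (∀ {i j} → f i ≡ f j → i ≡ j) × (∀ i → f i ∈ₛ K) × (∀ {x} → x ∈ₛ K → ∃[ i ] f i ≡ x)
enumerate [] = (λ ()) , (λ { {()} }) , (λ ()) , λ ()
enumerate (outside ∷ K) with enumerate K
... | f , inj , f∈ , onto = Fin.suc ∘ f , inj ∘ Finₚ.suc-injective , there ∘ f∈ ,
  λ { (there x∈) → case onto x∈ of λ (i , eq) → i , cong Fin.suc eq }
enumerate {suc m} (inside ∷ K) with enumerate K
... | f , inj , f∈ , onto = g , g-inj , g∈ ,
    λ { here → Fin.zero , refl ; (there x∈) → case onto x∈ of λ (i , eq) → Fin.suc i , cong Fin.suc eq }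
  where
  g : Fin (suc ∣ K ∣) → Fin (suc m)
  g Fin.zero    = Fin.zero
  g (Fin.suc i) = Fin.suc (f i)
  g-inj : ∀ {i j} → g i ≡ g j → i ≡ j
  g-inj {Fin.zero}  {Fin.zero}  _  = refl
  g-inj {Fin.suc i} {Fin.suc j} eq = cong Fin.suc (inj (Finₚ.suc-injective eq))
  g∈ : ∀ i → g i ∈ₛ inside ∷ K
  g∈ Fin.zero    = here
  g∈ (Fin.suc i) = there (f∈ i)

injective⇒≤∣∣ : ∀ {k m} {K : Subset m} (f : Fin k → Fin m) →
  (∀ {i j} → f i ≡ f j → i ≡ j) → (∀ i → f i ∈ₛ K) → k ≤ ∣ K ∣
injective⇒≤∣∣ {k} {K = K} f f-inj f∈ = Finₚ.injective⇒≤ {f = index} λ {i} {j} eq → f-inj (begin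
    f i            ≡⟨ sym (proj₂ (onto (f∈ i))) ⟩
    g (index i)    ≡⟨ cong g eq ⟩
    g (index j)    ≡⟨ proj₂ (onto (f∈ j)) ⟩
    f j            ∎)
  where
  g = proj₁ (enumerate K)
  onto = proj₂ (proj₂ (proj₂ (enumerate K)))
  index : Fin k → Fin ∣ K ∣
  index i = proj₁ (onto (f∈ i))

covering⇒∣∣≤ : ∀ {k m} {K : Subset m} (f : Fin k → Fin m) →
  (∀ {x} → x ∈ₛ K → ∃[ i ] x ≡ f i) → ∣ K ∣ ≤ k
covering⇒∣∣≤ {k} {K = K} f cover = Finₚ.injective⇒≤ {f = code} λ {i} {j} eq → g-inj (begin
    g i           ≡⟨ proj₂ (cover (g∈ i)) ⟩
    f (code i)    ≡⟨ cong f eq ⟩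
    f (code j)    ≡⟨ sym (proj₂ (cover (g∈ j))) ⟩
    g j           ∎)
  where
  g = proj₁ (enumerate K)
  g-inj = proj₁ (proj₂ (enumerate K))
  g∈ = proj₁ (proj₂ (proj₂ (enumerate K)))
  code : Fin ∣ K ∣ → Fin k
  code i = proj₁ (cover (g∈ i))

abstract
  p-part : ∀ {p} → 1 < p → ∀ k → .{{NonZero k}} → ∃[ b ] ∃[ m ] (k ≡ p ^ b * m × ¬ p ∣ m)
  p-part {p} 1<p = <-rec (λ k → .{{NonZero k}} → ∃[ b ] ∃[ m ] (k ≡ p ^ b * m × ¬ p ∣ m)) step
    where
    step : ∀ k → (∀ {l} → l < k → .{{NonZero l}} → ∃[ b ] ∃[ m ] (l ≡ p ^ b * m × ¬ p ∣ m)) →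
           .{{NonZero k}} → ∃[ b ] ∃[ m ] (k ≡ p ^ b * m × ¬ p ∣ m)
    step k rec with p ∣? k
    ... | no p∤k = 0 , k , sym (ℕₚ.+-identityʳ k) , p∤k
    ... | yes (divides (suc l) refl) with rec (ℕₚ.m<m*n (suc l) p 1<p)
    ... | b , m , eq , p∤m = suc b , m , trans (*-comm (suc l) p)
      (trans (cong (p *_) eq) (sym (ℕₚ.*-assoc p (p ^ b) m))) , p∤m

-- Existence of the characters and elements that define φ.

module Existence (G : FiniteAbelianGroup) (q : ℕ) (prime : Prime (3 + q)) where
  open PrimeExponent G q prime

  pth-powers : Subgroup
  pth-powers = record
    { Mem  = λ x → ∃[ y ] x ≡ pow y p
    ; mem? = λ x → any? (λ y → x Finₚ.≟ pow y p)
    ; e∈   = e , sym (pow-e p)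
    ; ·∈   = λ { (y , refl) (y′ , refl) → y · y′ , sym (pow-· y y′ p) } }

  module _ (M : Subgroup) where
    open Subgroup M

    pow∣∈ : ∀ {x d} → pow x p ∈ M → p ∣ d → pow x d ∈ M
    pow∣∈ {x} x^p∈ (divides k refl) =
      subst Mem (sym (trans (pow-* x k p) (pow-comm x k p))) (pow∈ k x^p∈)

    coprime∈ : ∀ {x d} → pow x p ∈ M → ¬ p ∣ d → pow x d ∈ M → x ∈ M
    coprime∈ {x} {d} x^p∈ p∤d x^d∈ with coprime-Bézout (prime-coprime prime p∤d)
    ... | Bézout.+- s t eq = cancel∈ʳ (pow∣∈ {d = t * p} x^p∈ (divides t refl))
      (subst Mem (trans (trans (sym (pow-* x d s)) (cong (pow x) (*-comm d s))) (cong (pow x) (sym eq))) (pow∈ s x^d∈))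
    ... | Bézout.-+ s t eq = cancel∈ʳ
      (subst Mem (trans (sym (pow-* x d s)) (cong (pow x) (*-comm d s))) (pow∈ s x^d∈))
      (subst (λ k → pow x k ∈ M) (sym eq) (pow∣∈ x^p∈ (divides t refl)))

  -- A subgroup maximal among those containing A but not x has index p if A contains all
  -- p-th powers, and x generates the quotient.
  module Separate (A : Subgroup) (pth⊆A : ∀ y → pow y p ∈ A) (x : Fin n) (x∉A : x ∉ A) where
    State : Set₁
    State = Σ Subgroup λ H → x ∉ H × (∀ {y} → y ∈ A → y ∈ H)

    maximal : ∃[ s ] ((∀ {y} → y ∈ A → y ∈ proj₁ s) × (∀ y → y ∈ proj₁ s ⊎ x ∈ proj₁ s ⟨ y ⟩))
    maximal = saturate {State = State} {_⊑_ = λ s t → ∀ {y} → y ∈ proj₁ s → y ∈ proj₁ t}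
        {Good = λ y s → y ∈ proj₁ s ⊎ x ∈ proj₁ s ⟨ y ⟩}
        (λ y∈ → y∈) (λ s t y∈ → t (s y∈))
        (λ {g} {s} {t} s⊑t → λ { (inj₁ y∈) → inj₁ (s⊑t y∈)
                               ; (inj₂ x∈) → inj₂ (⟨⟩-mono {proj₁ s} {proj₁ t} g s⊑t x∈) })
        step (A , x∉A , λ y∈ → y∈)
      where
      step : ∀ y (s : State) → ∃[ t ] ((∀ {w} → w ∈ proj₁ s → w ∈ proj₁ t) × (y ∈ proj₁ t ⊎ x ∈ proj₁ t ⟨ y ⟩))
      step y s@(H , _ , A⊆H) with Subgroup.mem? (H ⟨ y ⟩) x
      ... | yes x∈ = s , (λ w∈ → w∈) , inj₂ x∈
      ... | no x∉  = (H ⟨ y ⟩ , x∉ , λ w∈ → ⟨⟩-⊇ H y (A⊆H w∈)) , ⟨⟩-⊇ H y , inj₁ (g∈⟨g⟩ H y)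

    M : Subgroup
    M = proj₁ (proj₁ maximal)
    open Subgroup M

    x∉M : x ∉ M
    x∉M = proj₁ (proj₂ (proj₁ maximal))

    A⊆M : ∀ {y} → y ∈ A → y ∈ M
    A⊆M = proj₂ (proj₂ (proj₁ maximal))

    pth∈ : ∀ y → pow y p ∈ M
    pth∈ y = A⊆M (pth⊆A y)

    pow-x∈⇒∣ : ∀ {d} → pow x d ∈ M → p ∣ d
    pow-x∈⇒∣ {d} x^d∈ with p ∣? d
    ... | yes p∣d = p∣d
    ... | no p∤d  = ⊥-elim (x∉M (coprime∈ M (pth∈ x) p∤d x^d∈))

    -- y lies in the coset M x^i, since 2 + q is −1 modulo p.
    Coset : Fin n → ℕ → Set
    Coset y i = y · pow x (i * (2 + q)) ∈ M

    x^ip∈M : ∀ i → pow x (i * (2 + q) + i) ∈ M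
    x^ip∈M i = pow∣∈ M {x} (pth∈ x) (divides i (trans (+-comm _ i) (sym (*-suc i (2 + q)))))

    coset-· : ∀ {y y′ i j} → Coset y i → Coset y′ j → Coset (y · y′) (i + j)
    coset-· {y} {y′} {i} {j} yi y′j = subst Mem (begin
      y · pow x (i * (2 + q)) · (y′ · pow x (j * (2 + q)))
        ≡⟨ solve 4 (λ y u y′ v → (y ⊕ u) ⊕ (y′ ⊕ v) ⊜ (y ⊕ y′) ⊕ (u ⊕ v)) refl y _ y′ _ ⟩
      y · y′ · (pow x (i * (2 + q)) · pow x (j * (2 + q)))
        ≡⟨ cong (y · y′ ·_) (trans (sym (pow-+ x (i * (2 + q)) _)) (cong (pow x) (sym (ℕₚ.*-distribʳ-+ (2 + q) i j)))) ⟩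
      y · y′ · pow x ((i + j) * (2 + q)) ∎) (·∈ yi y′j)

    coset-unique : ∀ {y i j} → Coset y i → Coset y j → i % p ≡ j % p
    coset-unique {y} {i} {j} yi yj = begin
      i % p                            ≡⟨ sym (%-remove-+ʳ i (pow-x∈⇒∣ mixed)) ⟩
      (i + (i * (2 + q) + j)) % p      ≡⟨ cong (_% p) (sym (+-assoc i (i * (2 + q)) j)) ⟩
      (i + i * (2 + q) + j) % p        ≡⟨ %-remove-+ˡ j (divides i (sym (*-suc i (2 + q)))) ⟩
      j % p                            ∎
      where
      mixed : pow x (i * (2 + q) + j) ∈ M
      mixed = cancel∈ˡ yj (subst Mem (begin
        y · pow x (i * (2 + q)) · pow x (j * (2 + q) + j)
          ≡⟨ cong (y · pow x (i * (2 + q)) ·_) (pow-+ x (j * (2 + q)) j) ⟩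
        y · pow x (i * (2 + q)) · (pow x (j * (2 + q)) · pow x j)
          ≡⟨ solve 4 (λ y u v w → (y ⊕ u) ⊕ (v ⊕ w) ⊜ (y ⊕ v) ⊕ (u ⊕ w)) refl y _ _ _ ⟩
        y · pow x (j * (2 + q)) · (pow x (i * (2 + q)) · pow x j)
          ≡⟨ cong (y · pow x (j * (2 + q)) ·_) (sym (pow-+ x (i * (2 + q)) j)) ⟩
        y · pow x (j * (2 + q)) · pow x (i * (2 + q) + j) ∎) (·∈ yi (x^ip∈M j)))

    coset-% : ∀ {y i} → Coset y i → Coset y (i % p)
    coset-% {y} {i} yi = cancel∈ʳ (pow∣∈ M {x} {(i / p * p) * (2 + q)} (pth∈ x)
        (divides (i / p * (2 + q)) (eq (i / p) q)))
      (subst Mem (begin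
        y · pow x (i * (2 + q))
          ≡⟨ cong (λ k → y · pow x (k * (2 + q))) (m≡m%n+[m/n]*n i p) ⟩
        y · pow x ((i % p + i / p * p) * (2 + q))
          ≡⟨ cong (λ k → y · pow x k) (ℕₚ.*-distribʳ-+ (2 + q) (i % p) (i / p * p)) ⟩
        y · pow x (i % p * (2 + q) + i / p * p * (2 + q))
          ≡⟨ cong (y ·_) (pow-+ x (i % p * (2 + q)) _) ⟩
        y · (pow x (i % p * (2 + q)) · pow x (i / p * p * (2 + q)))
          ≡⟨ sym (assoc _ _ _) ⟩
        y · pow x (i % p * (2 + q)) · pow x (i / p * p * (2 + q)) ∎) yi)
      where
      eq : ∀ k q → k * (3 + q) * (2 + q) ≡ k * (2 + q) * (3 + q)
      eq = solve-∀

    -- The square of `2 + q` is `1 + (1 + q) * p`, so negating the exponent twice changes the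
    -- element only by a p-th power, which lies in `M`.
    coset-negate : ∀ {y} j → y · pow x j ∈ M → Coset y (j * (2 + q))
    coset-negate {y} j y∈ = subst Mem (begin
        y · pow x j · pow x (j * (1 + q) * p)
          ≡⟨ trans (assoc _ _ _) (cong (y ·_) (sym (pow-+ x j _))) ⟩
        y · pow x (j + j * (1 + q) * p)
          ≡⟨ cong (λ k → y · pow x k) (eq j q) ⟩
        y · pow x (j * (2 + q) * (2 + q)) ∎)
      (·∈ y∈ (pow∣∈ M {x} (pth∈ x) (divides (j * (1 + q)) refl)))
      where
      eq : ∀ j q → j + j * (1 + q) * (3 + q) ≡ j * (2 + q) * (2 + q)
      eq = solve-∀

    -- If `y ∉ M`, maximality gives x = m y^k with m in `M`. Here p does not divide k, since
    -- otherwise `x` would lie in `M`; inverting k modulo p expresses `y` through `x` modulo `M`.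
    coset : ∀ y → ∃[ i ] Coset y i
    coset y with proj₂ (proj₂ maximal) y
    ... | inj₁ y∈M = 0 , subst Mem (sym (idʳ y)) y∈M
    ... | inj₂ x∈ with ⟨⟩-elim M y x∈
    ... | m , m∈M , k , x≡ with p ∣? k
    ... | yes p∣k = ⊥-elim (x∉M (subst Mem (sym x≡) (·∈ m∈M (pow∣∈ M (pth∈ y) p∣k))))
    ... | no p∤k with coprime-Bézout (prime-coprime prime p∤k)
    ... | Bézout.+- s t eq = s , cancel∈ʳ (·∈ (pow∈ s m∈M) (pow∣∈ M (pth∈ y) (divides t refl)))
        (subst Mem (sym (begin
          y · pow x (s * (2 + q)) · (pow m s · pow y (t * p))
            ≡⟨ solve 4 (λ y u m v → (y ⊕ u) ⊕ (m ⊕ v) ⊜ u ⊕ (m ⊕ (y ⊕ v))) refl y _ _ _ ⟩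
          pow x (s * (2 + q)) · (pow m s · pow y (1 + t * p))
            ≡⟨ cong (λ k → pow x (s * (2 + q)) · (pow m s · pow y k)) (trans eq (*-comm s k)) ⟩
          pow x (s * (2 + q)) · (pow m s · pow y (k * s))
            ≡⟨ cong (λ w → pow x (s * (2 + q)) · w) (x^s s) ⟩
          pow x (s * (2 + q)) · pow x s
            ≡⟨ sym (pow-+ x (s * (2 + q)) s) ⟩
          pow x (s * (2 + q) + s) ∎)) (x^ip∈M s))
      where
      x^s : ∀ s → pow m s · pow y (k * s) ≡ pow x s
      x^s s = begin
        pow m s · pow y (k * s)        ≡⟨ cong (pow m s ·_) (pow-* y k s) ⟩
        pow m s · pow (pow y k) s      ≡⟨ sym (pow-· m (pow y k) s) ⟩
        pow (m · pow y k) s            ≡⟨ cong (λ w → pow w s) (sym x≡) ⟩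
        pow x s                        ∎
    ... | Bézout.-+ s t eq = s * (2 + q) , coset-negate s
        (subst Mem (sym (begin
          y · pow x s                            ≡⟨ cong (λ w → y · pow w s) x≡ ⟩
          y · pow (m · pow y k) s                ≡⟨ cong (y ·_) (trans (pow-· m _ s) (cong (pow m s ·_) (sym (pow-* y k s)))) ⟩
          y · (pow m s · pow y (k * s))          ≡⟨ solve 3 (λ y m v → y ⊕ (m ⊕ v) ⊜ m ⊕ (y ⊕ v)) refl y _ _ ⟩
          pow m s · pow y (1 + k * s)            ≡⟨ cong (λ l → pow m s · pow y l) (trans (cong suc (*-comm k s)) eq) ⟩
          pow m s · pow y (t * p)                ∎))
          (·∈ (pow∈ s m∈M) (pow∣∈ M (pth∈ y) (divides t refl))))

    separating : Character
    separating = record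
      { value   = value
      ; bounded = λ y → m%n<n (proj₁ (coset y)) p
      ; homo    = λ y y′ → trans (sym (m%n%n≡m%n (proj₁ (coset (y · y′))) p))
          (coset-unique {y · y′} {value (y · y′)} {value y + value y′} (in-coset (y · y′))
            (coset-· {y} {y′} {value y} {value y′} (in-coset y) (in-coset y′)))
      ; homo-e  = value-∈M e e∈ }
      where
      value : Fin n → ℕ
      value y = proj₁ (coset y) % p
      in-coset : ∀ y → Coset y (value y)
      in-coset y = coset-% {y} {proj₁ (coset y)} (proj₂ (coset y))
      value-∈M : ∀ y → y ∈ M → value y ≡ 0
      value-∈M y y∈M = coset-unique {y} {proj₁ (coset y)} {0} (proj₂ (coset y)) (subst Mem (sym (idʳ y)) y∈M)

    separating-A : ∀ {y} → y ∈ A → Character.value separating y ≡ 0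
    separating-A {y} y∈A =
      coset-unique {y} {proj₁ (coset y)} {0} (proj₂ (coset y)) (subst Mem (sym (idʳ y)) (A⊆M y∈A))

    separating-x : Character.value separating x ≡ 1
    separating-x = coset-unique {x} {proj₁ (coset x)} {1} (proj₂ (coset x))
      (subst (λ k → pow x (suc k) ∈ M) (sym (ℕₚ.*-identityˡ (2 + q))) (pth∈ x))

  abstract
    separate : (A : Subgroup) → (∀ y → pow y p ∈ A) → (x : Fin n) → x ∉ A →
      Σ Character λ χ → Character.value χ x ≡ 1 × (∀ y → y ∈ A → Character.value χ y ≡ 0)
    separate A pth⊆A x x∉A = separating , separating-x , λ y → separating-A {y}
      where open Separate A pth⊆A x x∉A

  record IndependentPair (P : Subset n) : Set where
    field
      c z   : Fin n
      c∈P   : c ∈ₛ P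
      z∈P   : z ∈ₛ P
      c^p   : pow c p ≡ e
      z^p   : pow z p ≡ e
      z≢e   : z ≢ e
      c∉⟨z⟩ : ∀ j → c ≢ pow z j

  p>1 : 1 < p
  p>1 = s≤s (s≤s z≤n)

  pow∈P : ∀ {P} → IsSubgroup P → ∀ {x} i → x ∈ₛ P → pow x i ∈ₛ P
  pow∈P P≤G zero    x∈ = IsSubgroup.e∈ P≤G
  pow∈P P≤G (suc i) x∈ = IsSubgroup.·∈ P≤G x∈ (pow∈P P≤G i x∈)

  module _ {P : Subset n} (P≤G : IsSubgroup P) {k : ℕ} (∣P∣≡ : ∣ P ∣ ≡ p ^ k) where
    open IsSubgroup P≤G

    pow-exponent : ∀ {x} → x ∈ₛ P → pow x (p ^ k) ≡ e
    pow-exponent {x} x∈P = subst (λ m → pow x m ≡ e) ∣P∣≡ (pow-∣∣ P≤G x∈P)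

    maximal-order : ∀ k → (∀ {x} → x ∈ₛ P → pow x (p ^ k) ≡ e) →
      (∀ {x} → x ∈ₛ P → x ≡ e) ⊎
      (∃[ l ] ∃[ x ] (x ∈ₛ P × pow x (p ^ l) ≢ e × (∀ {y} → y ∈ₛ P → pow y (p ^ suc l) ≡ e)))
    maximal-order zero    bound = inj₁ (λ {x} x∈ → trans (sym (idʳ x)) (bound x∈))
    maximal-order (suc l) bound with any? (λ x → x ∈? P ×-dec ¬? (pow x (p ^ l) Finₚ.≟ e))
    ... | yes (x , x∈ , ≢e) = inj₂ (l , x , x∈ , ≢e , bound)
    ... | no none = maximal-order l (λ {x} x∈ → decidable-stable (pow x (p ^ l) Finₚ.≟ e) (λ ≢e → none (x , x∈ , ≢e)))

    ⟨⟩-trivial : ∀ z {x} → x ∈ trivial ⟨ z ⟩ → ∃[ j ] x ≡ pow z j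
    ⟨⟩-trivial z x∈ with ⟨⟩-elim trivial z x∈
    ... | _ , refl , j , x≡ = j , trans x≡ (idˡ _)

    -- By induction `pow y p` is some x^j. The exponent bound makes z^j trivial for `z` = `pow x L`,
    -- so j = i p; then y x^(-i) is killed by p and hence is a power of `z`.
    generates : ∀ {x L} → x ∈ₛ P → pow (pow x L) p ≡ e → pow x L ≢ e →
      (∀ {y} → y ∈ₛ P → pow (pow y p) L ≡ e) →
      (∀ y → y ∈ₛ P → pow y p ≡ e → ∃[ j ] y ≡ pow (pow x L) j) →
      ∀ k {y} → y ∈ₛ P → pow y (p ^ k) ≡ e → ∃[ j ] y ≡ pow x j
    generates x∈P z^p z≢e bound order-p zero    {y} y∈P y^1 = 0 , trans (sym (idʳ y)) y^1
    generates {x} {L} x∈P z^p z≢e bound order-p (suc k) {y} y∈P y^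
      with generates {x} {L} x∈P z^p z≢e bound order-p k {pow y p} (pow∈P P≤G p y∈P) (trans (sym (pow-* y p (p ^ k))) y^)
    ... | j , y^p≡x^j with pow≡e⇒∣ {pow x L} {j} z^p z≢e
            (trans (pow-comm x L j) (trans (cong (λ w → pow w L) (sym y^p≡x^j)) (bound y∈P)))
    ... | divides i refl with order-p (y · inv (pow x i)) (·∈ y∈P (inv∈ (pow∈P P≤G i x∈P)))
            (trans (pow-· y _ p) (trans (cong₂ _·_ y^p≡x^j
              (trans (pow-inv (pow x i) p) (cong inv (sym (pow-* x i p))))) (invʳ _)))
    ... | r , eq = L * r + i , (begin
        y                                ≡⟨ sym (·-inv-· (pow x i) y) ⟩
        y · inv (pow x i) · pow x i      ≡⟨ cong (_· pow x i) eq ⟩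
        pow (pow x L) r · pow x i        ≡⟨ cong (_· pow x i) (sym (pow-* x L r)) ⟩
        pow x (L * r) · pow x i          ≡⟨ sym (pow-+ x (L * r) i) ⟩
        pow x (L * r + i)                ∎)

    -- If all elements of order p lie in ⟨z⟩ and z is a power of an element x of maximal
    -- order, then x generates P.
    independentPair : ¬ IsCyclic P → IndependentPair P
    independentPair ¬cyclic with maximal-order k pow-exponent
    ... | inj₁ P≡e = ⊥-elim (¬cyclic (e , e∈ , λ x x∈ → 0 , P≡e x∈))
    ... | inj₂ (l , x , x∈P , z≢e , bound) =
        [ (λ (c , c∈P , c^p , c∉) → record
            { c = c ; z = z ; c∈P = c∈P ; z∈P = pow∈P P≤G (p ^ l) x∈P ; c^p = c^p
            ; z^p = z^p ; z≢e = z≢e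
            ; c∉⟨z⟩ = λ { j refl → c∉ (Subgroup.pow∈ (trivial ⟨ z ⟩) j (g∈⟨g⟩ trivial z)) } })
        , (λ order-p → ⊥-elim (¬cyclic (x , x∈P , λ y y∈P →
            generates {x} {p ^ l} x∈P z^p z≢e bound′ order-p k y∈P (pow-exponent y∈P))))
        ]′ (search z)
      where
      z = pow x (p ^ l)
      bound′ : ∀ {y} → y ∈ₛ P → pow (pow y p) (p ^ l) ≡ e
      bound′ {y} y∈P = trans (sym (pow-* y p (p ^ l))) (bound y∈P)
      z^p : pow z p ≡ e
      z^p = trans (pow-comm x (p ^ l) p) (bound′ x∈P)
      search : ∀ z → (∃[ c ] (c ∈ₛ P × pow c p ≡ e × c ∉ trivial ⟨ z ⟩)) ⊎
                     (∀ c → c ∈ₛ P → pow c p ≡ e → ∃[ j ] c ≡ pow z j)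
      search z with any? (λ c → c ∈? P ×-dec pow c p Finₚ.≟ e ×-dec ¬? (Subgroup.mem? (trivial ⟨ z ⟩) c))
      ... | yes found = inj₁ found
      ... | no none = inj₂ λ c c∈P c^p → ⟨⟩-trivial z {c}
        (decidable-stable (Subgroup.mem? (trivial ⟨ z ⟩) c) (λ c∉ → none (c , c∈P , c^p , c∉)))

  module _ {P : Subset n} (pair : IndependentPair P) where
    open IndependentPair pair

    abstract
      -- Otherwise G is generated by `a` and the p^l-th powers for every l. With n = p^l m, raising
      -- to the m-th power kills the latter, so c^m and z^m both lie in the cyclic group of
      -- `pow a m`. Comparing them there gives a relation that contradicts the independence of `c`
      -- and `z`.
      not-cyclic-mod-p : ∀ a → ∃[ x ] x ∉ pth-powers ⟨ a ⟩
      not-cyclic-mod-p a = ¬∀⟶∃¬ n _ (Subgroup.mem? (pth-powers ⟨ a ⟩)) impossible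
        where
        module _ (generated : ∀ x → x ∈ pth-powers ⟨ a ⟩) where
          high-power : ∀ k x → ∃[ y ] ∃[ j ] x ≡ pow y (p ^ k) · pow a j
          high-power zero    x = x , 0 , sym (trans (idʳ _) (idʳ x))
          high-power (suc k) x with high-power k x
          ... | y , j , x≡ with ⟨⟩-elim pth-powers a (generated y)
          ... | _ , (y′ , refl) , i , refl = y′ , i * p ^ k + j , (begin
            x                                                              ≡⟨ x≡ ⟩
            pow (pow y′ p · pow a i) (p ^ k) · pow a j                     ≡⟨ cong (_· pow a j) (pow-· (pow y′ p) _ (p ^ k)) ⟩
            pow (pow y′ p) (p ^ k) · pow (pow a i) (p ^ k) · pow a j       ≡⟨ assoc _ _ _ ⟩
            pow (pow y′ p) (p ^ k) · (pow (pow a i) (p ^ k) · pow a j)     ≡⟨ cong₂ (λ u v → u · (v · pow a j)) (sym (pow-* y′ p (p ^ k))) (sym (pow-* a i (p ^ k))) ⟩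
            pow y′ (p ^ suc k) · (pow a (i * p ^ k) · pow a j)             ≡⟨ cong (pow y′ (p ^ suc k) ·_) (sym (pow-+ a (i * p ^ k) j)) ⟩
            pow y′ (p ^ suc k) · pow a (i * p ^ k + j)                     ∎)

          impossible : ⊥
          impossible with p-part p>1 n {{nonZero-n}}
          ... | l , m , n≡ , p∤m with high-power l c | high-power l z
          ... | y , i , c≡ | y′ , j , z≡ = prime≢1 (i⊥j (p∣i′ , p∣j′))
            where
            kill : ∀ {x y} i → x ≡ pow y (p ^ l) · pow a i → pow x m ≡ pow (pow a m) i
            kill {x} {y} i refl = begin
              pow (pow y (p ^ l) · pow a i) m            ≡⟨ pow-· _ _ m ⟩
              pow (pow y (p ^ l)) m · pow (pow a i) m    ≡⟨ cong₂ _·_ (trans (sym (pow-* y (p ^ l) m)) (trans (cong (pow y) (sym n≡)) (pow-n y))) (pow-comm a i m) ⟩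
              e · pow (pow a m) i                        ≡⟨ idˡ _ ⟩
              pow (pow a m) i                            ∎
            z^m≢e : j ≢ 0
            z^m≢e refl = p∤m (pow≡e⇒∣ z^p z≢e (kill 0 z≡))
            d = gcd i j
            instance
              d≢0 : NonZero d
              d≢0 = ≢-nonZero (gcd[m,n]≢0 i j (inj₂ z^m≢e))
            -- The exponents are divided by their gcd, because the contradiction will be that p
            -- divides both; `j ≢ 0` keeps the gcd nonzero.
            i′ j′ : ℕ
            i′ = i / d
            j′ = j / d
            i⊥j : Coprime i′ j′
            i⊥j = coprime-/gcd i j
            relation : pow c (m * j′) ≡ pow z (m * i′)
            relation = begin
              pow c (m * j′)             ≡⟨ pow-* c m j′ ⟩
              pow (pow c m) j′           ≡⟨ cong (λ w → pow w j′) (kill i c≡) ⟩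
              pow (pow u i) j′           ≡⟨ sym (pow-* u i j′) ⟩
              pow u (i * j′)             ≡⟨ cong (pow u) (begin
                i * j′              ≡⟨ cong (_* j′) (sym (m/n*n≡m (gcd[m,n]∣m i j))) ⟩
                i′ * d * j′         ≡⟨ eq i′ d j′ ⟩
                j′ * d * i′         ≡⟨ cong (_* i′) (m/n*n≡m (gcd[m,n]∣n i j)) ⟩
                j * i′              ∎) ⟩
              pow u (j * i′)             ≡⟨ pow-* u j i′ ⟩
              pow (pow u j) i′           ≡⟨ cong (λ w → pow w i′) (sym (kill j z≡)) ⟩
              pow (pow z m) i′           ≡⟨ sym (pow-* z m i′) ⟩
              pow z (m * i′)             ∎
              where
              u = pow a m
              eq : ∀ x d y → x * d * y ≡ y * d * x
              eq = solve-∀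
            p∣mj′ : p ∣ m * j′
            p∣mj′ = m%n≡0⇒n∣m (m * j′) p (independent c^p c∉⟨z⟩ {m * j′} {0} {0} {m * i′}
              (trans (idʳ _) (trans relation (sym (idˡ _)))))
            p∣j′ : p ∣ j′
            p∣j′ = [ ⊥-elim ∘ p∤m , (λ p∣ → p∣) ]′ (euclidsLemma m j′ prime p∣mj′)
            p∣mi′ : p ∣ m * i′
            p∣mi′ = pow≡e⇒∣ z^p z≢e (trans (sym relation) (pow∣e p∣mj′))
              where
              pow∣e : ∀ {d} → p ∣ d → pow c d ≡ e
              pow∣e (divides r refl) = pow-*≡e c^p r
            p∣i′ : p ∣ i′
            p∣i′ = [ ⊥-elim ∘ p∤m , (λ p∣ → p∣) ]′ (euclidsLemma m i′ prime p∣mi′)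
            prime≢1 : p ≢ 1
            prime≢1 ()

    -- Both characters kill p-th powers, hence `c` and `z`. It remains to choose `a` and `b`
    -- independent modulo p-th powers, and to let each character kill one of them and take value 1
    -- on the other.
    twist-Ω⊆pth : (∀ w → pow w p ≡ e → w ∈ pth-powers) → Twist
    twist-Ω⊆pth Ω⊆pth = record
      { a = a ; b = b ; c = c ; z = z ; ψ = ψ ; ω = ω
      ; ψa = ψa ; ωa = ω-A a (g∈⟨g⟩ pth-powers a)
      ; ψb = ψ-A b (g∈⟨g⟩ pth-powers b) ; ωb = ωb
      ; ψc = ψ-A c (⟨⟩-⊇ pth-powers b {c} (Ω⊆pth c c^p))
      ; ψz = ψ-A z (⟨⟩-⊇ pth-powers b {z} (Ω⊆pth z z^p))
      ; ωz = ω-A z (⟨⟩-⊇ pth-powers a {z} (Ω⊆pth z z^p))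
      ; c-type = inj₂ (ω-A c (⟨⟩-⊇ pth-powers a {c} (Ω⊆pth c c^p)))
      ; c^p = c^p ; z^p = z^p ; z≢e = z≢e ; c∉⟨z⟩ = c∉⟨z⟩ }
      where
      a b : Fin n
      -- Adjoining `e` adds nothing, so this is just an element that is not a p-th power.
      a = proj₁ (not-cyclic-mod-p e)
      b = proj₁ (not-cyclic-mod-p a)
      a∉⟨e⟩ : a ∉ pth-powers ⟨ e ⟩
      a∉⟨e⟩ = proj₂ (not-cyclic-mod-p e)
      b∉⟨a⟩ : b ∉ pth-powers ⟨ a ⟩
      b∉⟨a⟩ = proj₂ (not-cyclic-mod-p a)
      pth∈ : ∀ g y → pow y p ∈ pth-powers ⟨ g ⟩
      pth∈ g y = ⟨⟩-⊇ pth-powers g {pow y p} (y , refl)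
      a∉⟨b⟩ : a ∉ pth-powers ⟨ b ⟩
      -- Exchange: if a = y b^j with p dividing j, then `a` is a p-th power; otherwise `b` lies in
      -- the subgroup generated by `a` and the p-th powers.
      a∉⟨b⟩ a∈ with ⟨⟩-elim pth-powers b {a} a∈
      ... | y , y∈ , j , a≡ with p ∣? j
      ... | yes p∣j = a∉⟨e⟩ (⟨⟩-⊇ pth-powers e {a} (subst (_∈ pth-powers) (sym a≡)
        (Subgroup.·∈ pth-powers {y} {pow b j} y∈ (pow∣∈ pth-powers {b} {j} (b , refl) p∣j))))
      ... | no p∤j = b∉⟨a⟩ (coprime∈ (pth-powers ⟨ a ⟩) {b} {j} (pth∈ a b) p∤j
        (Subgroup.cancel∈ˡ (pth-powers ⟨ a ⟩) {y} {pow b j} (⟨⟩-⊇ pth-powers a {y} y∈)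
          (subst (_∈ pth-powers ⟨ a ⟩) a≡ (g∈⟨g⟩ pth-powers a))))
      Ψ = separate (pth-powers ⟨ b ⟩) (pth∈ b) a a∉⟨b⟩
      Ω = separate (pth-powers ⟨ a ⟩) (pth∈ a) b b∉⟨a⟩
      ψ = proj₁ Ψ
      ω = proj₁ Ω
      ψa = proj₁ (proj₂ Ψ)
      ωb = proj₁ (proj₂ Ω)
      ψ-A = proj₂ (proj₂ Ψ)
      ω-A = proj₂ (proj₂ Ω)

    product : Fin n → Fin n → Fin (p * p) → Fin n
    product x y k = let i , j = remQuot {p} p k in pow x (toℕ i) · pow y (toℕ j)

    product-injective : ∀ {k k′} → product c z k ≡ product c z k′ → k ≡ k′
    product-injective {k} {k′} eq = begin
        k                                          ≡⟨ sym (Finₚ.combine-remQuot {p} p k) ⟩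
        combine i j                                ≡⟨ cong₂ combine i≡i′ j≡j′ ⟩
        combine i′ j′                              ≡⟨ Finₚ.combine-remQuot {p} p k′ ⟩
        k′                                         ∎
      where
      i  = proj₁ (remQuot {p} p k)
      j  = proj₂ (remQuot {p} p k)
      i′ = proj₁ (remQuot {p} p k′)
      j′ = proj₂ (remQuot {p} p k′)
      cancel% : ∀ (i j : Fin p) → toℕ i % p ≡ toℕ j % p → i ≡ j
      cancel% i j eq = Finₚ.toℕ-injective
        (trans (sym (m<n⇒m%n≡m (Finₚ.toℕ<n i))) (trans eq (m<n⇒m%n≡m (Finₚ.toℕ<n j))))
      i≡i′ : i ≡ i′
      i≡i′ = cancel% i i′ (independent c^p c∉⟨z⟩ {toℕ i} {toℕ j} {toℕ i′} {toℕ j′} eq)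
      j≡j′ : j ≡ j′
      j≡j′ = cancel% j j′ (pow-injective {z} {toℕ j} {toℕ j′} z^p z≢e
        (cancelˡ (pow c (toℕ i)) (trans eq (cong (λ i → pow c (toℕ i) · pow z (toℕ j′)) (sym i≡i′)))))

    p²≤∣P∣ : IsSubgroup P → p * p ≤ ∣ P ∣
    p²≤∣P∣ P≤G = injective⇒≤∣∣ (product c z) product-injective
      λ i → IsSubgroup.·∈ P≤G (pow∈P P≤G (toℕ (proj₁ (remQuot {p} p i))) c∈P)
                              (pow∈P P≤G (toℕ (proj₂ (remQuot {p} p i))) z∈P)

    -- If G is generated by p-th powers together with `w` and `v` of order dividing p, then every
    -- x^m lies in ⟨w, v⟩, where m is the part of n prime to p. On `P` raising to the m-th power is
    -- invertible, so `P` has exponent p and at most p² elements; the independent pair gives the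
    -- opposite bound.
    module RankTwo (P≤G : IsSubgroup P) {k : ℕ} (∣P∣≡ : ∣ P ∣ ≡ p ^ k)
      {w v : Fin n} (w^p : pow w p ≡ e) (v^p : pow v p ≡ e)
      (generated : ∀ x → x ∈ pth-powers ⟨ w ⟩ ⟨ v ⟩)
      {l m : ℕ} (n≡ : n ≡ p ^ l * m) (p∤m : ¬ p ∣ m) where
      open IsSubgroup P≤G
      span-p : ∀ i j → pow (pow w i · pow v j) p ≡ e
      span-p i j = trans (pow-· _ _ p) (trans (cong₂ _·_
        (trans (pow-comm w i p) (trans (cong (λ x → pow x i) w^p) (pow-e i)))
        (trans (pow-comm v j p) (trans (cong (λ x → pow x j) v^p) (pow-e j)))) (idˡ e))

      decompose : ∀ x → ∃[ y ] ∃[ i ] ∃[ j ] x ≡ pow y p · (pow w i · pow v j)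
      decompose x with ⟨⟩-elim (pth-powers ⟨ w ⟩) v (generated x)
      ... | _ , h∈ , j , refl with ⟨⟩-elim pth-powers w h∈
      ... | _ , (y , refl) , i , refl = y , i , j , assoc _ _ _

      -- Decomposing the base again leaves `i` and `j` unchanged, since raising to the p-th power
      -- kills ⟨w, v⟩. This is why the exponent starts at p and not at 1.
      high-power : ∀ l x → ∃[ y ] ∃[ i ] ∃[ j ] x ≡ pow y (p ^ suc l) · (pow w i · pow v j)
      high-power zero    x with decompose x
      ... | y , i , j , x≡ = y , i , j , trans x≡ (cong (λ k → pow y k · (pow w i · pow v j)) (sym (ℕₚ.*-identityʳ p)))
      high-power (suc l) x with high-power l x
      ... | y , i , j , refl with decompose y
      ... | y′ , i′ , j′ , refl = y′ , i , j , cong (_· (pow w i · pow v j)) (begin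
        pow (pow y′ p · s) (p * p ^ l)                     ≡⟨ pow-· (pow y′ p) s (p * p ^ l) ⟩
        pow (pow y′ p) (p * p ^ l) · pow s (p * p ^ l)     ≡⟨ cong₂ _·_ (sym (pow-* y′ p (p * p ^ l)))
                                                                (trans (pow-* s p (p ^ l)) (trans (cong (λ x → pow x (p ^ l)) (span-p i′ j′)) (pow-e (p ^ l)))) ⟩
        pow y′ (p * (p * p ^ l)) · e                       ≡⟨ idʳ _ ⟩
        pow y′ (p * (p * p ^ l))                           ∎)
        where s = pow w i′ · pow v j′

      m⊥p : Coprime m p
      m⊥p = prime-coprime prime p∤m

      pow-m : ∀ x → ∃[ i ] ∃[ j ] pow x m ≡ pow w i · pow v j
      pow-m x with high-power l x
      ... | y , i , j , refl = i * m , j * m , (begin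
        pow (pow y (p * p ^ l) · s) m                    ≡⟨ pow-· _ s m ⟩
        pow (pow y (p * p ^ l)) m · pow s m              ≡⟨ cong₂ _·_ y-kill (trans (pow-· _ _ m) (cong₂ _·_ (sym (pow-* w i m)) (sym (pow-* v j m)))) ⟩
        e · (pow w (i * m) · pow v (j * m))              ≡⟨ idˡ _ ⟩
        pow w (i * m) · pow v (j * m)                    ∎)
        where
        s = pow w i · pow v j
        y-kill : pow (pow y (p * p ^ l)) m ≡ e
        y-kill = begin
          pow (pow y (p * p ^ l)) m      ≡⟨ sym (pow-* y (p * p ^ l) m) ⟩
          pow y (p * p ^ l * m)          ≡⟨ cong (pow y) (trans (ℕₚ.*-assoc p (p ^ l) m) (cong (p *_) (sym n≡))) ⟩
          pow y (p * n)                  ≡⟨ pow-*≡e {y} {n} (pow-n y) p ⟩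
          e                              ∎

      coprime-kill : ∀ k {y} → pow y (p ^ k) ≡ e → pow y m ≡ e → y ≡ e
      coprime-kill zero    {y} y^1 _ = trans (sym (idʳ y)) y^1
      coprime-kill (suc k) {y} y^ y^m
        with s , eq ← pow-coprime m⊥p (coprime-kill k {pow y p} (trans (sym (pow-* y p (p ^ k))) y^)
               (trans (pow-comm y p m) (trans (cong (λ w → pow w p) y^m) (pow-e p)))) =
        trans (sym eq) (trans (cong (λ w → pow w s) y^m) (pow-e s))

      exponent-p : ∀ {x} → x ∈ₛ P → pow x p ≡ e
      exponent-p {x} x∈P with pow-m x
      ... | i , j , x^m = coprime-kill k (pow-exponent P≤G {k} ∣P∣≡ (pow∈P P≤G p x∈P))
        (trans (pow-comm x p m) (trans (cong (λ w → pow w p) x^m) (span-p i j)))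

      coordinates : ∀ {x} → x ∈ₛ P → ∃[ i ] x ≡ product w v i
      coordinates {x} x∈P =
        let i , j , x^m = pow-m x
            s , eq = pow-coprime m⊥p (exponent-p x∈P)
        in combine (mod (i * s)) (mod (j * s)) , (begin
        x                                                  ≡⟨ sym eq ⟩
        pow (pow x m) s                                    ≡⟨ cong (λ y → pow y s) x^m ⟩
        pow (pow w i · pow v j) s                          ≡⟨ pow-· _ _ s ⟩
        pow (pow w i) s · pow (pow v j) s                  ≡⟨ cong₂ _·_ (reduce w^p i s) (reduce v^p j s) ⟩
        pow w (toℕ (mod (i * s))) · pow v (toℕ (mod (j * s)))
          ≡⟨ cong (λ (i , j) → pow w (toℕ i) · pow v (toℕ j)) (sym (Finₚ.remQuot-combine (mod (i * s)) (mod (j * s)))) ⟩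
        product w v (combine (mod (i * s)) (mod (j * s)))  ∎)
        where
        mod : ℕ → Fin p
        mod i = fromℕ< (m%n<n i p)
        reduce : ∀ {w} → pow w p ≡ e → ∀ i s → pow (pow w i) s ≡ pow w (toℕ (mod (i * s)))
        reduce {w} w^p i s = begin
          pow (pow w i) s              ≡⟨ sym (pow-* w i s) ⟩
          pow w (i * s)                ≡⟨ sym (pow-% w^p (i * s)) ⟩
          pow w ((i * s) % p)          ≡⟨ cong (pow w) (sym (Finₚ.toℕ-fromℕ< (m%n<n (i * s) p))) ⟩
          pow w (toℕ (mod (i * s)))    ∎

      upper : ∣ P ∣ ≤ p * p
      upper = covering⇒∣∣≤ (product w v) coordinates

      p*p≡p^2 : p * p ≡ p ^ 2
      p*p≡p^2 = cong (p *_) (sym (ℕₚ.*-identityʳ p))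

      isElemAbRank2 : IsElemAbRank2 p P
      isElemAbRank2 = trans (ℕₚ.≤-antisym {∣ P ∣} {p * p} upper (p²≤∣P∣ P≤G)) p*p≡p^2 , λ x x∈P → exponent-p {x} x∈P

    rank-two : IsSubgroup P → ∀ {k} → ∣ P ∣ ≡ p ^ k → ∀ {w v} → pow w p ≡ e → pow v p ≡ e →
      (∀ x → x ∈ pth-powers ⟨ w ⟩ ⟨ v ⟩) → IsElemAbRank2 p P
    rank-two P≤G {k} ∣P∣≡ {w} {v} w^p v^p generated with p-part p>1 n {{nonZero-n}}
    ... | l , m , n≡ , p∤m = RankTwo.isElemAbRank2 P≤G {k} ∣P∣≡ {w} {v} w^p v^p generated {l} {m} n≡ p∤m

    -- As `w` is not a p-th power, some ω takes value 1 on it, so `w` can serve both as `b` and as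
    -- `c`. Being of value 1, it is not a power of any `v` in the kernel of ω.
    twist-Ω⊈pth : IsSubgroup P → ∀ {k} → ∣ P ∣ ≡ p ^ k → ¬ IsElemAbRank2 p P →
      ∀ {w} → pow w p ≡ e → w ∉ pth-powers → Twist
    twist-Ω⊈pth P≤G {k} ∣P∣≡ ¬rank2 {w} w^p w∉ = construct z₀
      where
      Ω = separate pth-powers (λ y → y , refl) w w∉
      ω = proj₁ Ω
      ωw = proj₁ (proj₂ Ω)
      open Character ω renaming (value to ω[_])
      cancels : ∀ k l → (k * l + l * (k * (2 + q))) ≡ (k * l) * p
      cancels k l = eq k l q
        where
        eq : ∀ k l q → k * l + l * (k * (2 + q)) ≡ (k * l) * (3 + q)
        eq = solve-∀

      ω-pow-· : ∀ x y i j → ω[ pow x i · pow y j ] ≡ (i * ω[ x ] + j * ω[ y ]) % p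
      ω-pow-· x y i j = begin
        ω[ pow x i · pow y j ]                        ≡⟨ homo _ _ ⟩
        (ω[ pow x i ] + ω[ pow y j ]) % p             ≡⟨ cong₂ (λ k l → (k + l) % p) (value-pow x i) (value-pow y j) ⟩
        ((i * ω[ x ]) % p + (j * ω[ y ]) % p) % p     ≡⟨ sym (%-distribˡ-+ (i * ω[ x ]) (j * ω[ y ]) p) ⟩
        (i * ω[ x ] + j * ω[ y ]) % p                 ∎

      -- A character to ℤ/p cannot be injective on the rank 2 group ⟨c, z⟩: c^ω(z) z^(-ω(c)) is in
      -- its kernel, and is nontrivial by independence when ω(z) ≠ 0.
      z₀ : ∃[ z ] (pow z p ≡ e × z ≢ e × ω[ z ] ≡ 0)
      z₀ with ω[ z ] ℕₚ.≟ 0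
      ... | yes ωz = z , z^p , z≢e , ωz
      ... | no ωz≢0 = pow c ω[ z ] · pow z (ω[ c ] * (2 + q)) ,
        trans (pow-· _ _ p) (trans (cong₂ _·_
          (trans (pow-comm c ω[ z ] p) (trans (cong (λ x → pow x ω[ z ]) c^p) (pow-e ω[ z ])))
          (trans (pow-comm z (ω[ c ] * (2 + q)) p) (trans (cong (λ x → pow x (ω[ c ] * (2 + q))) z^p) (pow-e (ω[ c ] * (2 + q)))))) (idˡ e)) ,
        (λ eq → ωz≢0 (trans (sym (value-% z))
          (independent c^p c∉⟨z⟩ {ω[ z ]} {ω[ c ] * (2 + q)} {0} {0} (trans eq (sym (idˡ e)))))) ,
        trans (ω-pow-· c z ω[ z ] (ω[ c ] * (2 + q)))
          (trans (cong (_% p) (trans (cong₂ _+_ (*-comm ω[ z ] ω[ c ]) (*-comm (ω[ c ] * (2 + q)) ω[ z ]))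
            (cancels ω[ c ] ω[ z ]))) (m*n%n≡0 (ω[ c ] * ω[ z ]) p))

      construct : ∃[ z ] (pow z p ≡ e × z ≢ e × ω[ z ] ≡ 0) → Twist
      construct (v , v^p , v≢e , ωv) = record
        { a = a ; b = w ; c = w ; z = v ; ψ = ψ ; ω = ω
        ; ψa = trans (ψₕ.value-0ʳ a₀ (ψₕ.value-pow-0 i ψw)) (proj₁ (proj₂ Ψ))
        ; ωa = ωa
        ; ψb = ψw ; ωb = ωw ; ψc = ψw
        ; ψz = proj₂ (proj₂ Ψ) v (g∈⟨g⟩ ⟨w⟩ v) ; ωz = ωv
        ; c-type = inj₁ refl ; c^p = w^p ; z^p = v^p ; z≢e = v≢e
        ; c∉⟨z⟩ = λ j w≡ → case trans (sym ωw) (trans (cong ω[_] w≡) (value-pow-0 j ωv)) of λ () }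
        where
        ⟨w⟩ ⟨w,v⟩ : Subgroup
        ⟨w⟩   = pth-powers ⟨ w ⟩
        ⟨w,v⟩ = ⟨w⟩ ⟨ v ⟩
        outside-⟨w,v⟩ : ∃[ a ] a ∉ ⟨w,v⟩
        outside-⟨w,v⟩ = ¬∀⟶∃¬ n _ (Subgroup.mem? ⟨w,v⟩) (λ gen → ¬rank2 (rank-two P≤G {k} ∣P∣≡ w^p v^p gen))
        a₀ : Fin n
        a₀ = proj₁ outside-⟨w,v⟩
        Ψ = separate ⟨w,v⟩ (λ y → ⟨⟩-⊇ ⟨w⟩ v {pow y p} (⟨⟩-⊇ pth-powers w {pow y p} (y , refl)))
                     a₀ (proj₂ outside-⟨w,v⟩)
        ψ = proj₁ Ψ
        module ψₕ = Character ψ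
        -- The factor `pow w i` cancels ω(a₀), as ω(w) = 1, and leaves ψ unchanged, as ψ kills `w`.
        i = ω[ a₀ ] * (2 + q)
        a = a₀ · pow w i
        ψw : ψₕ.value w ≡ 0
        ψw = proj₂ (proj₂ Ψ) w (⟨⟩-⊇ ⟨w⟩ v {w} (g∈⟨g⟩ pth-powers w))
        ωa : ω[ a ] ≡ 0
        ωa = begin
          ω[ a₀ · pow w i ]                            ≡⟨ cong (λ u → ω[ u · pow w i ]) (sym (pow-1 a₀)) ⟩
          ω[ pow a₀ 1 · pow w i ]                      ≡⟨ ω-pow-· a₀ w 1 i ⟩
          (1 * ω[ a₀ ] + i * ω[ w ]) % p               ≡⟨ cong (λ k → (1 * ω[ a₀ ] + i * k) % p) ωw ⟩
          (1 * ω[ a₀ ] + i * 1) % p                    ≡⟨ cong (_% p) (trans (cong₂ _+_ (*-comm 1 ω[ a₀ ]) (*-comm i 1)) (cancels ω[ a₀ ] 1)) ⟩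
          (ω[ a₀ ] * 1 * p) % p                        ≡⟨ m*n%n≡0 (ω[ a₀ ] * 1) p ⟩
          0                                            ∎

  twist : ∀ {P} → IsSylow p P → ¬ IsCyclic P → ¬ IsElemAbRank2 p P → Twist
  twist {P} (P≤G , k , ∣P∣≡ , _) ¬cyclic ¬rank2 =
      decide (any? (λ w → pow w p Finₚ.≟ e ×-dec ¬? (Subgroup.mem? pth-powers w)))
    where
    pair : IndependentPair P
    pair = independentPair P≤G {k} ∣P∣≡ ¬cyclic
    decide : Dec (∃[ w ] (pow w p ≡ e × w ∉ pth-powers)) → Twist
    decide (yes (w , w^p , w∉)) = twist-Ω⊈pth pair P≤G {k} ∣P∣≡ ¬rank2 {w} w^p w∉
    decide (no none) = twist-Ω⊆pth pair
      (λ w w^p → decidable-stable (Subgroup.mem? pth-powers w) (λ w∉ → none (w , w^p , w∉)))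

open import Data.Fin.Subset using (_∉_)

theorem4p1 : (G : FiniteAbelianGroup) → let open FiniteAbelianGroup G in
    (p : ℕ) → Prime p → p ≢ 2 →
    (P : Subset n) → IsSylow p P → ¬ IsCyclic P → ¬ IsElemAbRank2 p P →
    ∃[ S ] (e ∉ S × IsProper S × CayleyIndex S p × HasNonabelianRegularSubgroup S)
theorem4p1 G 0 pr = ⊥-elim (¬prime[0] pr)
theorem4p1 G 1 pr = ⊥-elim (¬prime[1] pr)
theorem4p1 G 2 pr p≢2 = ⊥-elim (p≢2 refl)
theorem4p1 G (suc (suc (suc q))) pr _ P sylow ¬cyclic ¬rank2 =
  CayleyIndex-p.conclusion G q pr (Existence.twist G q pr sylow ¬cyclic ¬rank2)
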